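{- Let $L$ be a geometric lattice of rank $r+1$ and let $(h_0,\dots,h_r)$ be the $h$-vector of its order complex $\Delta(L)$. Then for every integer $i$ with $i \le r/2$ (and $i\ge 1$ for the first inequality), $$h_{i-1}\le h_i \qquad\text{and}\qquad h_i \le h_{r-i}.$$
   Context: A geometric lattice is a finite graded atomic lattice whose rank function $\rho$ satisfies $\rho(x\vee y)+\rho(x\wedge y)\le \rho(x)+\rho(y)$. The order complex $\Delta(L)$ is the simplicial complex on vertex set $L\setminus\{\hat 0,\hat 1\}$ whose faces are the chains of $L\setminus\{\hat0,\hat1\}$; for $L$ of rank $r+1$ it is pure of dimension $r-1$. If $f_i$ denotes the number of faces of $\Delta(L)$ of cardinality $i$ ($f_0=1$), the $h$-vector $(h_0,\dots,h_r)$ is defined by $\sum_{i=0}^r f_i (x-1)^{r-i}=\sum_{i=0}^r h_i x^{r-i}$. -}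

module Defs where

open import Data.Nat as ℕ using (ℕ; zero; suc; _∸_)
open import Data.Nat.Combinatorics using (_C_)
open import Data.Integer as ℤ using (ℤ; +_; -_)
open import Data.Fin using (Fin)
open import Data.Fin.Subset using (Subset; _∈_; ∣_∣; inside; outside)
open import Data.Fin.Subset.Properties using (_∈?_)
open import Data.Fin.Properties using (all?; _≟_)
open import Data.Vec using (_∷_; [])
open import Data.List using (List; _∷_; []; map; _++_; filter; length)
open import Data.Product using (_×_; _,_)
open import Data.Sum using (_⊎_)
open import Relation.Binary.PropositionalEquality using (_≡_; _≢_)
open import Relation.Binary.Structures using (IsPartialOrder)
open import Relation.Binary.Definitions using (Decidable)
open import Relation.Binary.Lattice.Definitions using (Supremum; Infimum)
open import Relation.Nullary using (Dec; ¬_)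
open import Relation.Nullary.Decidable using (_×-dec_; _⊎-dec_; _→-dec_; ¬?)

Covers : {n : ℕ} → (Fin n → Fin n → Set) → Fin n → Fin n → Set
Covers _≤_ x y = ((x ≤ y) × (x ≢ y)) × (∀ z → x ≤ z → z ≤ y → (z ≡ x) ⊎ (z ≡ y))

record GeometricLattice : Set₁ where
  field
    n              : ℕ
    _≤_            : Fin n → Fin n → Set
    isPartialOrder : IsPartialOrder _≡_ _≤_
    _≤?_           : Decidable _≤_
    _∨_            : Fin n → Fin n → Fin n
    _∧_            : Fin n → Fin n → Fin n
    ∨-supremum     : Supremum _≤_ _∨_
    ∧-infimum      : Infimum _≤_ _∧_
    bot            : Fin n
    top            : Fin n
    bot-min        : ∀ x → bot ≤ x
    top-max        : ∀ x → x ≤ top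
    ρ              : Fin n → ℕ
    ρ-bot          : ρ bot ≡ 0
    ρ-cover        : ∀ x y → Covers _≤_ x y → ρ y ≡ suc (ρ x)
    -- atomic: x is the least upper bound of the atoms below it
    atomic         : ∀ x y → (∀ a → Covers _≤_ bot a → a ≤ x → a ≤ y) → x ≤ y
    semimodular    : ∀ x y → ρ (x ∨ y) ℕ.+ ρ (x ∧ y) ℕ.≤ ρ x ℕ.+ ρ y

  rank : ℕ
  rank = ρ top

  IsFace : Subset n → Set
  IsFace S = (∀ x → x ∈ S → (¬ x ≡ bot) × (¬ x ≡ top))
           × (∀ x y → x ∈ S → y ∈ S → (x ≤ y) ⊎ (y ≤ x))

  isFace? : ∀ S → Dec (IsFace S)
  isFace? S =
    all? (λ x → (x ∈? S) →-dec (¬? (x ≟ bot) ×-dec ¬? (x ≟ top)))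
    ×-dec
    all? (λ x → all? (λ y → (x ∈? S) →-dec (y ∈? S) →-dec ((x ≤? y) ⊎-dec (y ≤? x))))

  FaceOfSize : ℕ → Subset n → Set
  FaceOfSize i S = IsFace S × (∣ S ∣ ≡ i)

  faceOfSize? : ∀ i S → Dec (FaceOfSize i S)
  faceOfSize? i S = isFace? S ×-dec (∣ S ∣ ℕ.≟ i)

allSubsets : (n : ℕ) → List (Subset n)
allSubsets zero    = [] ∷ []
allSubsets (suc n) = map (outside ∷_) (allSubsets n) ++ map (inside ∷_) (allSubsets n)

module _ (L : GeometricLattice) where
  open GeometricLattice L

  fvec : ℕ → ℕ
  fvec i = length (filter (faceOfSize? i) (allSubsets n))

  r : ℕ
  r = rank ∸ 1

signPow : ℕ → ℤ
signPow zero    = + 1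
signPow (suc k) = - signPow k

-- h-vector of Δ(L), via coefficient extraction in
--   Σ_{i=0}^r f_i (x-1)^{r-i} = Σ_{k=0}^r h_k x^{r-k},
-- i.e.  h_k = Σ_{i=0}^{k} (-1)^{k-i} C(r-i, k-i) f_i .
hvecAux : (L : GeometricLattice) → (k : ℕ) → (m : ℕ) → ℤ
hvecAux L k zero    = signPow k ℤ.* (+ ((r L) C k)) ℤ.* (+ fvec L 0)
hvecAux L k (suc m) = hvecAux L k m ℤ.+
  signPow (k ∸ suc m) ℤ.* (+ ((r L ∸ suc m) C (k ∸ suc m))) ℤ.* (+ fvec L (suc m))

hvec : GeometricLattice → ℕ → ℤ
hvec L k = hvecAux L k k

{-# OPTIONS --safe #-}

-- Label a cover x < y by the least atom below y but not below x.  In an interval exactly one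
-- maximal chain has increasing labels, so h_k counts the label words of maximal chains with
-- k descents.  Semimodularity shows that the set of label words is closed under replacing an
-- ascent by a descent: if p a b s is a label word and a < b, then so is p b a s.
--
-- Call a move p x q s ↦ p q x s, where q is a nonempty block of letters > x and the neighbours
-- of x q (if any) are < x, a hop.  It is a sequence of such replacements, adds one descent
-- and preserves the number of peaks.  With the conventions that a word begins with an ascent
-- and ends with a descent, a word of length r + 1 with e descents and c peaks can hop up
-- in r + 2 - e - c ways and down in e - c ways.  Double counting hops yields
--   (r + 2 - e - c) H(e, c) ≤ (e + 1 - c) H(e + 1, c)
-- for the number H(e, c) of such label words.  This is the normalized matching inequality of a
-- Boolean lattice of rank r + 2 - 2c, and both assertions follow for each c separately.
module Submission where

open import Defs
open import Data.Bool using (Bool; true; false; if_then_else_)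
open import Data.Empty using (⊥-elim)
open import Data.Fin using (Fin; zero; suc; toℕ)
import Data.Fin as Fin
open import Data.Fin.Induction using (po-wellFounded; po-noetherian; <-wellFounded)
open import Data.Fin.Properties using (toℕ-injective; all?; any?)
open import Data.Fin.Subset using (Subset; inside; outside; ∣_∣) renaming (_∈_ to _∈ₛ_)
open import Data.Fin.Subset.Properties using (_∈?_)
open import Data.Integer as ℤ using (ℤ) renaming (+_ to pos_)
import Data.Integer.Properties as ℤ
import Data.Integer.Tactic.RingSolver as ℤ-Solver
open import Data.List using (List; []; _∷_; _++_; map; filter; length; concatMap; allFin; upTo)
open import Data.List.Membership.Propositional using (_∈_)
open import Data.List.Membership.Propositional.Properties using (∈-allFin; ∈-upTo⁺)
open import Data.List.Properties using (map-++; map-∘; map-cong; length-++; ++-assoc)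
open import Data.List.Relation.Unary.All as All using (All; []; _∷_)
open import Data.List.Relation.Unary.All.Properties using (++⁻ʳ)
open import Data.List.Relation.Unary.Any using (here; there)
open import Data.List.Relation.Unary.Unique.Propositional using (Unique; []; _∷_)
open import Data.List.Relation.Unary.Unique.Propositional.Properties using (allFin⁺; upTo⁺)
open import Data.Nat
open import Data.Nat.Combinatorics using (_C_; nCk+nC[k+1]≡[n+1]C[k+1])
open import Data.Nat.ListAction using (sum)
open import Data.Nat.ListAction.Properties using (sum-++)
open import Data.Nat.Properties
open import Data.Nat.Tactic.RingSolver using (solve-∀)
open import Data.Product using (_×_; _,_; proj₁; proj₂; map₁; uncurry; ∃)
open import Data.Sum using (_⊎_; inj₁; inj₂)
open import Data.Vec using (_∷_; []; _[_]≔_; here; there)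
open import Data.Vec.Properties using ([]≔-minimal)
open import Function using (_∘_; flip; mk⇔)
open import Induction.WellFounded using (WellFounded; Acc; acc)
open import Relation.Binary.Definitions using (tri<; tri≈; tri>) renaming (Decidable to Decidable₂)
open import Relation.Binary.PropositionalEquality using (_≡_; _≢_; refl; sym; trans; cong; cong₂; subst; subst₂; module ≡-Reasoning)
open import Relation.Binary.Structures using (IsPartialOrder)
open import Relation.Nullary using (Dec; yes; no; does; ¬_)
open import Relation.Nullary.Decidable using (_×-dec_; _⊎-dec_; _→-dec_; ¬?; dec-true; dec-false; does-⇔)
open import Relation.Unary using (Pred; Decidable)

-- Finite sums and indicators

private variable
  X Y : Set
  Φ Ψ : Set

bit : Bool → ℕ
bit b = if b then 1 else 0

𝟙 : Dec Φ → ℕ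
𝟙 d = bit (does d)

𝟙-yes : (d : Dec Φ) → Φ → 𝟙 d ≡ 1
𝟙-yes (yes _) _ = refl
𝟙-yes (no ¬p) p = ⊥-elim (¬p p)

𝟙-no : (d : Dec Φ) → ¬ Φ → 𝟙 d ≡ 0
𝟙-no (yes p) ¬p = ⊥-elim (¬p p)
𝟙-no (no _)  _  = refl

𝟙-cong : (d : Dec Φ) (e : Dec Ψ) → (Φ → Ψ) → (Ψ → Φ) → 𝟙 d ≡ 𝟙 e
𝟙-cong (yes p) e f g = sym (𝟙-yes e (f p))
𝟙-cong (no ¬p) e f g = sym (𝟙-no e (¬p ∘ g))

𝟙-mono : (d : Dec Φ) (e : Dec Ψ) → (Φ → Ψ) → 𝟙 d ≤ 𝟙 e
𝟙-mono (yes p) e f = ≤-reflexive (sym (𝟙-yes e (f p)))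
𝟙-mono (no ¬p) e f = z≤n

𝟙-× : (d : Dec Φ) (e : Dec Ψ) → 𝟙 (d ×-dec e) ≡ 𝟙 d * 𝟙 e
𝟙-× (yes _) (yes _) = refl
𝟙-× (yes _) (no _)  = refl
𝟙-× (no _)  _       = refl

𝟙-guard : (d : Dec Φ) {m n : ℕ} → (Φ → m ≡ n) → 𝟙 d * m ≡ 𝟙 d * n
𝟙-guard (yes p) eq = cong (1 *_) (eq p)
𝟙-guard (no _)  _  = refl

𝟙-guard-≤ : (d : Dec Φ) (k l m : ℕ) → (Φ → k * m ≤ l * m) → k * (𝟙 d * m) ≤ l * (𝟙 d * m)
𝟙-guard-≤ (yes p) k l m le rewrite +-identityʳ m = le p
𝟙-guard-≤ (no _)  k l m le rewrite *-zeroʳ k = z≤n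

∑ : List X → (X → ℕ) → ℕ
∑ xs f = sum (map f xs)

∑-cong : (xs : List X) {f g : X → ℕ} → (∀ x → f x ≡ g x) → ∑ xs f ≡ ∑ xs g
∑-cong xs eq = cong sum (map-cong eq xs)

∑-mono : (xs : List X) {f g : X → ℕ} → (∀ x → f x ≤ g x) → ∑ xs f ≤ ∑ xs g
∑-mono []       le = z≤n
∑-mono (x ∷ xs) le = +-mono-≤ (le x) (∑-mono xs le)

∑-zero : (xs : List X) {f : X → ℕ} → (∀ x → f x ≡ 0) → ∑ xs f ≡ 0
∑-zero []       eq = refl
∑-zero (x ∷ xs) eq = cong₂ _+_ (eq x) (∑-zero xs eq)

∑-map : (h : X → Y) (xs : List X) (f : Y → ℕ) → ∑ (map h xs) f ≡ ∑ xs (f ∘ h)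
∑-map h xs f = cong sum (sym (map-∘ xs))

∑-++ : (xs ys : List X) (f : X → ℕ) → ∑ (xs ++ ys) f ≡ ∑ xs f + ∑ ys f
∑-++ xs ys f = trans (cong sum (map-++ f xs ys)) (sum-++ (map f xs) (map f ys))

∑-concatMap : (h : X → List Y) (xs : List X) (f : Y → ℕ) →
              ∑ (concatMap h xs) f ≡ ∑ xs (λ x → ∑ (h x) f)
∑-concatMap h []       f = refl
∑-concatMap h (x ∷ xs) f =
  trans (∑-++ (h x) (concatMap h xs) f) (cong (∑ (h x) f +_) (∑-concatMap h xs f))

+-interchange : ∀ a b c d → (a + b) + (c + d) ≡ (a + c) + (b + d)
+-interchange = solve-∀

∑-+ : (xs : List X) (f g : X → ℕ) → ∑ xs (λ x → f x + g x) ≡ ∑ xs f + ∑ xs g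
∑-+ []       f g = refl
∑-+ (x ∷ xs) f g =
  trans (cong (f x + g x +_) (∑-+ xs f g)) (+-interchange (f x) (g x) (∑ xs f) (∑ xs g))

∑-*ˡ : (xs : List X) (c : ℕ) (f : X → ℕ) → ∑ xs (λ x → c * f x) ≡ c * ∑ xs f
∑-*ˡ []       c f = sym (*-zeroʳ c)
∑-*ˡ (x ∷ xs) c f = trans (cong (c * f x +_) (∑-*ˡ xs c f)) (sym (*-distribˡ-+ c (f x) (∑ xs f)))

∑-comm : (xs : List X) (ys : List Y) (f : X → Y → ℕ) →
         ∑ xs (λ x → ∑ ys (f x)) ≡ ∑ ys (λ y → ∑ xs (λ x → f x y))
∑-comm []       ys f = sym (∑-zero ys (λ _ → refl))
∑-comm (x ∷ xs) ys f =
  trans (cong (∑ ys (f x) +_) (∑-comm xs ys f))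
        (sym (∑-+ ys (f x) (λ y → ∑ xs (λ x → f x y))))

∑-outside : {m : X} (xs : List X) (f : X → ℕ) → All (m ≢_) xs → (∀ x → x ≢ m → f x ≡ 0) → ∑ xs f ≡ 0
∑-outside []       f []        eq = refl
∑-outside (x ∷ xs) f (ne ∷ nes) eq = cong₂ _+_ (eq x (ne ∘ sym)) (∑-outside xs f nes eq)

∑-single : {m : X} (xs : List X) (f : X → ℕ) → Unique xs → m ∈ xs → (∀ x → x ≢ m → f x ≡ 0) → ∑ xs f ≡ f m
∑-single (x ∷ xs) f (ne ∷ _) (here refl) eq =
  trans (cong (f x +_) (∑-outside xs f ne eq)) (+-identityʳ (f x))
∑-single (x ∷ xs) f (ne ∷ uq) (there m∈) eq =
  cong₂ _+_ (eq x (All.lookup ne m∈)) (∑-single xs f uq m∈ eq)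

∑-allFin-single : ∀ {N} (m : Fin N) (f : Fin N → ℕ) → (∀ x → x ≢ m → f x ≡ 0) → ∑ (allFin N) f ≡ f m
∑-allFin-single {N} m f = ∑-single (allFin N) f (allFin⁺ N) (∈-allFin m)

length-filter-∑ : {Φ : Pred X _} (Φ? : Decidable Φ) (xs : List X) →
                  length (filter Φ? xs) ≡ ∑ xs (λ x → 𝟙 (Φ? x))
length-filter-∑ Φ? []       = refl
length-filter-∑ Φ? (x ∷ xs) with does (Φ? x)
... | true  = cong suc (length-filter-∑ Φ? xs)
... | false = length-filter-∑ Φ? xs

-- Words and valley hopping

-- Length at most m rather than exactly m, so that the factors of a word can be summed over independently.
words : (N m : ℕ) → List (List (Fin N))
words N zero    = [] ∷ []
words N (suc m) = [] ∷ concatMap (λ a → map (a ∷_) (words N m)) (allFin N)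

ascψ desψ peakψ : Bool → Bool → ℕ
ascψ  l r = bit l
desψ  l r = bit r
peakψ l r = bit l * bit r

bit-≤1 : ∀ b → bit b ≤ 1
bit-≤1 true  = ≤-refl
bit-≤1 false = z≤n

𝟙-<-> : ∀ m n → m ≢ n → 𝟙 (m <? n) + 𝟙 (n <? m) ≡ 1
𝟙-<-> m n m≢n with <-cmp m n
... | tri< lt _ ngt = cong₂ _+_ (𝟙-yes (m <? n) lt) (𝟙-no (n <? m) ngt)
... | tri≈ _ eq _ = ⊥-elim (m≢n eq)
... | tri> nlt _ gt = cong₂ _+_ (𝟙-no (m <? n) nlt) (𝟙-yes (n <? m) gt)

module _ {N : ℕ} where

  Word : Set
  Word = List (Fin N)

  ∑-words-suc : ∀ m (g : Word → ℕ) →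
    ∑ (words N (suc m)) g ≡ g [] + ∑ (allFin N) (λ a → ∑ (words N m) (λ w → g (a ∷ w)))
  ∑-words-suc m g = cong (g [] +_)
    (trans (∑-concatMap (λ a → map (a ∷_) (words N m)) (allFin N) g)
           (∑-cong (allFin N) (λ a → ∑-map (a ∷_) (words N m) g)))

  -- Peeling a letter off one factor lowers the length bound of that factor only; this restores a
  -- common bound, since the longest words contribute nothing.
  ∑-words-truncate : ∀ m (g : Word → ℕ) → (∀ w → m < length w → g w ≡ 0) →
    ∑ (words N (suc m)) g ≡ ∑ (words N m) g
  ∑-words-truncate zero g supp =
    trans (∑-words-suc 0 g)
          (cong (g [] +_) (∑-zero (allFin N) (λ a → trans (+-identityʳ _) (supp (a ∷ []) (s≤s z≤n)))))
  ∑-words-truncate (suc m) g supp =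
    trans (∑-words-suc (suc m) g)
    (trans (cong (g [] +_) (∑-cong (allFin N) (λ a →
              ∑-words-truncate m (λ w → g (a ∷ w)) (λ w lt → supp (a ∷ w) (s≤s lt)))))
           (sym (∑-words-suc m g)))

  -- Factorizations of words

  splits : Word → List (Word × Word)
  splits []      = ([] , []) ∷ []
  splits (a ∷ w) = ([] , a ∷ w) ∷ map (map₁ (a ∷_)) (splits w)

  ∑splits : Word → (Word → Word → ℕ) → ℕ
  ∑splits w F = ∑ (splits w) (uncurry F)

  ∑splits-∷ : ∀ a w F → ∑splits (a ∷ w) F ≡ F [] (a ∷ w) + ∑splits w (λ p s → F (a ∷ p) s)
  ∑splits-∷ a w F = cong (F [] (a ∷ w) +_) (∑-map (map₁ (a ∷_)) (splits w) (uncurry F))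

  ∑splits-cong : ∀ w {F G : Word → Word → ℕ} → (∀ p s → p ++ s ≡ w → F p s ≡ G p s) →
    ∑splits w F ≡ ∑splits w G
  ∑splits-cong []      eq = cong (_+ 0) (eq [] [] refl)
  ∑splits-cong (a ∷ w) {F} {G} eq =
    trans (∑splits-∷ a w F)
    (trans (cong₂ _+_ (eq [] (a ∷ w) refl) (∑splits-cong w (λ p s e → eq (a ∷ p) s (cong (a ∷_) e))))
           (sym (∑splits-∷ a w G)))

  ∑splits-zero : ∀ w {F : Word → Word → ℕ} → (∀ p s → p ++ s ≡ w → F p s ≡ 0) → ∑splits w F ≡ 0
  ∑splits-zero w eq = trans (∑splits-cong w {G = λ _ _ → 0} eq) (∑-zero (splits w) (λ _ → refl))

  foci : Word → List (Word × Fin N × Word)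
  foci []      = []
  foci (a ∷ w) = ([] , a , w) ∷ map (map₁ (a ∷_)) (foci w)

  ∑foci : Word → (Word → Fin N → Word → ℕ) → ℕ
  ∑foci w F = ∑ (foci w) (λ (p , x , s) → F p x s)

  ∑foci-∷ : ∀ a w F → ∑foci (a ∷ w) F ≡ F [] a w + ∑foci w (λ p x s → F (a ∷ p) x s)
  ∑foci-∷ a w F = cong (F [] a w +_) (∑-map (map₁ (a ∷_)) (foci w) (λ (p , x , s) → F p x s))

  ∑foci-cong : ∀ w {F G : Word → Fin N → Word → ℕ} → (∀ p x s → p ++ x ∷ s ≡ w → F p x s ≡ G p x s) →
    ∑foci w F ≡ ∑foci w G
  ∑foci-cong []      eq = refl
  ∑foci-cong (a ∷ w) {F} {G} eq =
    trans (∑foci-∷ a w F)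
    (trans (cong₂ _+_ (eq [] a w refl) (∑foci-cong w (λ p x s e → eq (a ∷ p) x s (cong (a ∷_) e))))
           (sym (∑foci-∷ a w G)))

  -- Each pair of factors comes from exactly one word, their concatenation. The support condition
  -- discards the pairs whose concatenation is too long to occur in `words N m`.
  ∑-words-splits : ∀ m (F : Word → Word → ℕ) → (∀ p s → m < length p + length s → F p s ≡ 0) →
    ∑ (words N m) (λ w → ∑splits w F) ≡ ∑ (words N m) (λ p → ∑ (words N m) (F p))
  ∑-words-splits zero F supp = refl
  ∑-words-splits (suc m) F supp = begin
    ∑ (words N (suc m)) (λ w → ∑splits w F)
      ≡⟨ ∑-words-suc m (λ w → ∑splits w F) ⟩
    F [] [] + 0 + ∑ letters (λ a → ∑ W (λ w → ∑splits (a ∷ w) F))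
      ≡⟨ cong₂ _+_ (+-identityʳ (F [] []))
                   (∑-cong letters λ a → trans (∑-cong W (λ w → ∑splits-∷ a w F)) (∑-+ W _ _)) ⟩
    F [] [] + ∑ letters (λ a → ∑ W (λ w → F [] (a ∷ w)) + ∑ W (λ w → ∑splits w (λ p s → F (a ∷ p) s)))
      ≡⟨ cong (F [] [] +_) (∑-+ letters _ _) ⟩
    F [] [] + (∑ letters (λ a → ∑ W (λ w → F [] (a ∷ w)))
               + ∑ letters (λ a → ∑ W (λ w → ∑splits w (λ p s → F (a ∷ p) s))))
      ≡⟨ sym (+-assoc (F [] []) _ _) ⟩
    F [] [] + ∑ letters (λ a → ∑ W (λ w → F [] (a ∷ w)))
               + ∑ letters (λ a → ∑ W (λ w → ∑splits w (λ p s → F (a ∷ p) s)))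
      ≡⟨ cong₂ _+_ (sym (∑-words-suc m (F []))) (∑-cong letters λ a →
           trans (∑-words-splits m (λ p s → F (a ∷ p) s) (λ p s lt → supp (a ∷ p) s (s≤s lt)))
                 (∑-cong W (λ p → sym (∑-words-truncate m (F (a ∷ p))
                    (λ s lt → supp (a ∷ p) s (s≤s (≤-trans lt (m≤n+m _ (length p))))))))) ⟩
    ∑ (words N (suc m)) (F []) + ∑ letters (λ a → ∑ W (λ p → ∑ (words N (suc m)) (F (a ∷ p))))
      ≡⟨ sym (∑-words-suc m (λ p → ∑ (words N (suc m)) (F p))) ⟩
    ∑ (words N (suc m)) (λ p → ∑ (words N (suc m)) (F p)) ∎
    where
    open ≡-Reasoning
    letters = allFin N
    W = words N m

  ∑-words-foci : ∀ m (F : Word → Fin N → Word → ℕ) →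
    (∀ p x s → m < length p + suc (length s) → F p x s ≡ 0) →
    ∑ (words N m) (λ w → ∑foci w F) ≡
    ∑ (words N m) (λ p → ∑ (allFin N) (λ x → ∑ (words N m) (F p x)))
  ∑-words-foci zero F supp =
    sym (trans (+-identityʳ _)
               (∑-zero (allFin N) (λ x → trans (+-identityʳ _) (supp [] x [] (s≤s z≤n)))))
  ∑-words-foci (suc m) F supp = begin
    ∑ (words N (suc m)) (λ w → ∑foci w F)
      ≡⟨ ∑-words-suc m (λ w → ∑foci w F) ⟩
    ∑ letters (λ a → ∑ W (λ w → ∑foci (a ∷ w) F))
      ≡⟨ (∑-cong letters λ a → trans (∑-cong W (λ w → ∑foci-∷ a w F)) (∑-+ W _ _)) ⟩
    ∑ letters (λ a → ∑ W (F [] a) + ∑ W (λ w → ∑foci w (λ p x s → F (a ∷ p) x s)))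
      ≡⟨ ∑-+ letters _ _ ⟩
    ∑ letters (λ a → ∑ W (F [] a)) + ∑ letters (λ a → ∑ W (λ w → ∑foci w (λ p x s → F (a ∷ p) x s)))
      ≡⟨ cong₂ _+_
           (∑-cong letters λ x → sym (∑-words-truncate m (F [] x) (λ s lt → supp [] x s (s≤s lt))))
           (∑-cong letters λ a →
             trans (∑-words-foci m (λ p x s → F (a ∷ p) x s) (λ p x s lt → supp (a ∷ p) x s (s≤s lt)))
                   (∑-cong W λ p → ∑-cong letters λ x → sym (∑-words-truncate m (F (a ∷ p) x)
                     (λ s lt → supp (a ∷ p) x s (s≤s (≤-trans (m≤n⇒m≤1+n lt) (m≤n+m _ (length p)))))))) ⟩
    ∑ letters (λ x → ∑ W′ (F [] x)) + ∑ letters (λ a → ∑ W (λ p → ∑ letters (λ x → ∑ W′ (F (a ∷ p) x))))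
      ≡⟨ sym (∑-words-suc m (λ p → ∑ letters (λ x → ∑ W′ (F p x)))) ⟩
    ∑ W′ (λ p → ∑ letters (λ x → ∑ W′ (F p x))) ∎
    where
    open ≡-Reasoning
    letters = allFin N
    W = words N m
    W′ = words N (suc m)

  -- Letters take values ≥ 1, so that 0 can serve as the value beyond either end of a word.
  val : Fin N → ℕ
  val a = suc (toℕ a)

  val-injective : ∀ {a b} → val a ≡ val b → a ≡ b
  val-injective = toℕ-injective ∘ suc-injective

  first : ℕ → Word → ℕ
  first e []      = e
  first e (a ∷ w) = val a

  last : ℕ → Word → ℕ
  last d []      = d
  last d (a ∷ w) = last (val a) w

  -- The arguments of ψ tell whether the left and the right neighbour of a letter are smaller than it.
  stat : (Bool → Bool → ℕ) → ℕ → ℕ → Word → ℕ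
  stat ψ d e []      = 0
  stat ψ d e (a ∷ w) = ψ (does (d <? val a)) (does (first e w <? val a)) + stat ψ (val a) e w

  first-++ : ∀ e p t → first (first e t) p ≡ first e (p ++ t)
  first-++ e []      t = refl
  first-++ e (a ∷ p) t = refl

  -- Letters see only their neighbours, so a cut is felt through one value on each side of it.
  stat-++ : ∀ ψ d e p t → stat ψ d e (p ++ t) ≡ stat ψ d (first e t) p + stat ψ (last d p) e t
  stat-++ ψ d e []      t = refl
  stat-++ ψ d e (a ∷ p) t =
    trans (cong₂ _+_ (cong (λ k → ψ (does (d <? val a)) (does (k <? val a))) (sym (first-++ e p t)))
                     (stat-++ ψ (val a) e p t))
          (sym (+-assoc (ψ (does (d <? val a)) (does (first (first e t) p <? val a)))
                        (stat ψ (val a) (first e t) p) (stat ψ (last (val a) p) e t)))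

  -- The outer value enters through a single comparison, so any value on the same side of the first
  -- letter may replace it.
  stat-congˡ : ∀ ψ d d′ e w → does (d <? first e w) ≡ does (d′ <? first e w) → stat ψ d e w ≡ stat ψ d′ e w
  stat-congˡ ψ d d′ e []      eq = refl
  stat-congˡ ψ d d′ e (a ∷ w) eq =
    cong (λ b → ψ b (does (first e w <? val a)) + stat ψ (val a) e w) eq

  stat-congʳ : ∀ ψ d e e′ w → does (e <? last d w) ≡ does (e′ <? last d w) → stat ψ d e w ≡ stat ψ d e′ w
  stat-congʳ ψ d e e′ []          eq = refl
  stat-congʳ ψ d e e′ (a ∷ [])    eq = cong (λ b → ψ (does (d <? val a)) b + 0) eq
  stat-congʳ ψ d e e′ (a ∷ b ∷ w) eq =
    cong (ψ (does (d <? val a)) (does (val b <? val a)) +_) (stat-congʳ ψ (val a) e e′ (b ∷ w) eq)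

  ∑foci-stat : ∀ ψ d e w →
    ∑foci w (λ p x s → ψ (does (last d p <? val x)) (does (first e s <? val x))) ≡ stat ψ d e w
  ∑foci-stat ψ d e []      = refl
  ∑foci-stat ψ d e (a ∷ w) =
    trans (∑foci-∷ a w _) (cong (ψ (does (d <? val a)) (does (first e w <? val a)) +_) (∑foci-stat ψ (val a) e w))

  -- The end of the word counts as a descent, the beginning as an ascent.
  asc des peak : Word → ℕ
  asc  = stat ascψ 0 0
  des  = stat desψ 0 0
  peak = stat peakψ 0 0

  stat-mono : ∀ {ψ χ} → (∀ l r → ψ l r ≤ χ l r) → ∀ d e w → stat ψ d e w ≤ stat χ d e w
  stat-mono le d e []      = z≤n
  stat-mono le d e (a ∷ w) = +-mono-≤ (le _ _) (stat-mono le (val a) e w)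

  peak≤des : ∀ w → peak w ≤ des w
  peak≤des = stat-mono (λ l r → ≤-trans (*-monoˡ-≤ (bit r) (bit-≤1 l)) (≤-reflexive (*-identityˡ (bit r)))) 0 0

  -- Each gap from `b` to the end of the word is either an ascent, counted at the letter on its
  -- right, or a descent, counted at the letter on its left. The third summand is the descent at
  -- `b`, which is not a letter of `w`.
  asc+des-after : ∀ b w → All (b ≢_) w → Unique w →
    stat ascψ (val b) 0 w + stat desψ (val b) 0 w + 𝟙 (first 0 w <? val b) ≡ suc (length w)
  asc+des-after b []      _          _         = 𝟙-yes (0 <? val b) (s≤s z≤n)
  asc+des-after b (a ∷ w) (b≢a ∷ _) (a∉w ∷ uw) = begin
    𝟙 (val b <? val a) + A + (𝟙 (first 0 w <? val a) + D) + 𝟙 (val a <? val b)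
      ≡⟨ shuffle (𝟙 (val b <? val a)) A (𝟙 (first 0 w <? val a)) D (𝟙 (val a <? val b)) ⟩
    (𝟙 (val b <? val a) + 𝟙 (val a <? val b)) + (A + D + 𝟙 (first 0 w <? val a))
      ≡⟨ cong₂ _+_ (𝟙-<-> (val b) (val a) (b≢a ∘ val-injective)) (asc+des-after a w a∉w uw) ⟩
    suc (suc (length w)) ∎
    where
    open ≡-Reasoning
    A = stat ascψ (val a) 0 w
    D = stat desψ (val a) 0 w
    shuffle : ∀ i j k l m → i + j + (k + l) + m ≡ i + m + (j + l + k)
    shuffle = solve-∀

  asc+des : ∀ a w → Unique (a ∷ w) → asc (a ∷ w) + des (a ∷ w) ≡ suc (length (a ∷ w))
  asc+des a w (a∉w ∷ uw) =
    trans (cong (λ k → k + stat ascψ (val a) 0 w + des (a ∷ w)) (𝟙-yes (0 <? val a) (s≤s z≤n)))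
          (cong suc (trans (shuffle (stat ascψ (val a) 0 w) (𝟙 (first 0 w <? val a)) (stat desψ (val a) 0 w))
                           (asc+des-after a w a∉w uw)))
    where
    shuffle : ∀ i j k → i + (j + k) ≡ i + k + j
    shuffle = solve-∀

  -- Counting hops

  _<·_ : Fin N → Fin N → Set
  x <· y = val x < val y

  above? : ∀ x q → Dec (All (x <·_) q)
  above? x = All.all? (λ y → val x <? val y)

  nonempty : Word → ℕ
  nonempty []      = 0
  nonempty (_ ∷ _) = 1

  𝟙-above-∷ : ∀ x a w → 𝟙 (above? x (a ∷ w)) ≡ 𝟙 (val x <? val a) * 𝟙 (above? x w)
  𝟙-above-∷ x a w =
    trans (𝟙-cong (above? x (a ∷ w)) ((val x <? val a) ×-dec above? x w) All.uncons (uncurry _∷_))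
          (𝟙-× (val x <? val a) (above? x w))

  -- The only split that counts takes for `q` the longest prefix of letters above `x`: as `x` does
  -- not occur in `t`, the letter that stops the prefix is below `x`, and so is the value 0 at the
  -- end.
  ∑splits-prefix-above : ∀ x t → All (x ≢_) t →
    ∑splits t (λ q s → 𝟙 (above? x q) * 𝟙 (first 0 s <? val x)) ≡ 1
  ∑splits-prefix-above x [] _ =
    cong (λ k → k + 0 + 0) (𝟙-yes (0 <? val x) (s≤s z≤n))
  ∑splits-prefix-above x (a ∷ t) (x≢a ∷ x∉t) = begin
    ∑splits (a ∷ t) F
      ≡⟨ ∑splits-∷ a t F ⟩
    𝟙 (val a <? val x) + 0 + ∑splits t (λ q s → 𝟙 (above? x (a ∷ q)) * 𝟙 (first 0 s <? val x))
      ≡⟨ cong₂ _+_ (+-identityʳ (𝟙 (val a <? val x))) (∑-cong (splits t) λ (q , s) →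
           trans (cong (_* 𝟙 (first 0 s <? val x)) (𝟙-above-∷ x a q))
                 (*-assoc (𝟙 (val x <? val a)) (𝟙 (above? x q)) _)) ⟩
    𝟙 (val a <? val x) + ∑splits t (λ q s → 𝟙 (val x <? val a) * F q s)
      ≡⟨ cong (𝟙 (val a <? val x) +_) (∑-*ˡ (splits t) (𝟙 (val x <? val a)) (uncurry F)) ⟩
    𝟙 (val a <? val x) + 𝟙 (val x <? val a) * ∑splits t F
      ≡⟨ cong (λ k → 𝟙 (val a <? val x) + 𝟙 (val x <? val a) * k) (∑splits-prefix-above x t x∉t) ⟩
    𝟙 (val a <? val x) + 𝟙 (val x <? val a) * 1
      ≡⟨ cong (𝟙 (val a <? val x) +_) (*-identityʳ _) ⟩
    𝟙 (val a <? val x) + 𝟙 (val x <? val a)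
      ≡⟨ 𝟙-<-> (val a) (val x) (x≢a ∘ sym ∘ val-injective) ⟩
    1 ∎
    where
    open ≡-Reasoning
    F : Word → Word → ℕ
    F q s = 𝟙 (above? x q) * 𝟙 (first 0 s <? val x)

  -- Dually, `q` must be the longest suffix of letters above `x`. The second summand is the case in
  -- which this run fills `t` and extends to `d`; it vanishes for `d` = 0, but the induction passes
  -- through other values.
  ∑splits-suffix-above : ∀ x d t → d ≢ val x → All (x ≢_) t →
    ∑splits t (λ p q → 𝟙 (last d p <? val x) * 𝟙 (above? x q)) + 𝟙 (val x <? d) * 𝟙 (above? x t) ≡ 1
  ∑splits-suffix-above x d [] d≢x _ =
    trans (shuffle (𝟙 (d <? val x)) (𝟙 (val x <? d))) (𝟙-<-> d (val x) d≢x)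
    where
    shuffle : ∀ i j → i * 1 + 0 + j * 1 ≡ i + j
    shuffle = solve-∀
  ∑splits-suffix-above x d (a ∷ t) d≢x (x≢a ∷ x∉t) = begin
    ∑splits (a ∷ t) (F d) + 𝟙 (val x <? d) * 𝟙 (above? x (a ∷ t))
      ≡⟨ cong (_+ 𝟙 (val x <? d) * 𝟙 (above? x (a ∷ t))) (∑splits-∷ a t (F d)) ⟩
    𝟙 (d <? val x) * 𝟙 (above? x (a ∷ t)) + ∑splits t (F (val a)) + 𝟙 (val x <? d) * 𝟙 (above? x (a ∷ t))
      ≡⟨ shuffle (𝟙 (d <? val x)) (𝟙 (val x <? d)) (𝟙 (above? x (a ∷ t))) (∑splits t (F (val a))) ⟩
    (𝟙 (d <? val x) + 𝟙 (val x <? d)) * 𝟙 (above? x (a ∷ t)) + ∑splits t (F (val a))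
      ≡⟨ cong (λ k → k * 𝟙 (above? x (a ∷ t)) + ∑splits t (F (val a))) (𝟙-<-> d (val x) d≢x) ⟩
    1 * 𝟙 (above? x (a ∷ t)) + ∑splits t (F (val a))
      ≡⟨ cong (_+ ∑splits t (F (val a))) (trans (*-identityˡ _) (𝟙-above-∷ x a t)) ⟩
    𝟙 (val x <? val a) * 𝟙 (above? x t) + ∑splits t (F (val a))
      ≡⟨ +-comm _ (∑splits t (F (val a))) ⟩
    ∑splits t (F (val a)) + 𝟙 (val x <? val a) * 𝟙 (above? x t)
      ≡⟨ ∑splits-suffix-above x (val a) t (x≢a ∘ sym ∘ val-injective) x∉t ⟩
    1 ∎
    where
    open ≡-Reasoning
    F : ℕ → Word → Word → ℕ
    F d p q = 𝟙 (last d p <? val x) * 𝟙 (above? x q)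
    shuffle : ∀ i j k l → i * k + l + j * k ≡ (i + j) * k + l
    shuffle = solve-∀

  -- The same indicator serves the hop up from `p x q s` and the hop down from `p q x s`, so that
  -- the two counts can be compared term by term.
  hop : Word → Fin N → Word → Word → ℕ
  hop p x q s = nonempty q * (𝟙 (last 0 p <? val x) * (𝟙 (above? x q) * 𝟙 (first 0 s <? val x)))

  upHops downHops : Word → ℕ
  upHops   w = ∑foci w (λ p x t → ∑splits t (λ q s → hop p x q s))
  downHops w = ∑foci w (λ t x s → ∑splits t (λ p q → hop p x q s))

  ∑splits-nonempty-left : ∀ t (F : Word → Word → ℕ) →
    ∑splits t (λ q s → nonempty q * F q s) + F [] t ≡ ∑splits t F
  ∑splits-nonempty-left [] F = sym (+-identityʳ (F [] []))
  ∑splits-nonempty-left (a ∷ t) F = begin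
    ∑splits (a ∷ t) (λ q s → nonempty q * F q s) + F [] (a ∷ t)
      ≡⟨ cong (_+ F [] (a ∷ t)) (∑splits-∷ a t (λ q s → nonempty q * F q s)) ⟩
    ∑splits t (λ q s → 1 * F (a ∷ q) s) + F [] (a ∷ t)
      ≡⟨ cong (_+ F [] (a ∷ t)) (∑-cong (splits t) (λ (q , s) → *-identityˡ (F (a ∷ q) s))) ⟩
    ∑splits t (λ q s → F (a ∷ q) s) + F [] (a ∷ t)
      ≡⟨ +-comm _ (F [] (a ∷ t)) ⟩
    F [] (a ∷ t) + ∑splits t (λ q s → F (a ∷ q) s)
      ≡⟨ sym (∑splits-∷ a t F) ⟩
    ∑splits (a ∷ t) F ∎
    where open ≡-Reasoning

  ∑splits-nonempty-right : ∀ t (F : Word → Word → ℕ) →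
    ∑splits t (λ p q → nonempty q * F p q) + F t [] ≡ ∑splits t F
  ∑splits-nonempty-right [] F = sym (+-identityʳ (F [] []))
  ∑splits-nonempty-right (a ∷ t) F = begin
    ∑splits (a ∷ t) (λ p q → nonempty q * F p q) + F (a ∷ t) []
      ≡⟨ cong (_+ F (a ∷ t) []) (∑splits-∷ a t (λ p q → nonempty q * F p q)) ⟩
    1 * F [] (a ∷ t) + ∑splits t (λ p q → nonempty q * F (a ∷ p) q) + F (a ∷ t) []
      ≡⟨ +-assoc (1 * F [] (a ∷ t)) _ _ ⟩
    1 * F [] (a ∷ t) + (∑splits t (λ p q → nonempty q * F (a ∷ p) q) + F (a ∷ t) [])
      ≡⟨ cong₂ _+_ (*-identityˡ (F [] (a ∷ t))) (∑splits-nonempty-right t (λ p q → F (a ∷ p) q)) ⟩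
    F [] (a ∷ t) + ∑splits t (λ p q → F (a ∷ p) q)
      ≡⟨ sym (∑splits-∷ a t F) ⟩
    ∑splits (a ∷ t) F ∎
    where open ≡-Reasoning

  Unique-focus : ∀ (p : Word) {x s} → Unique (p ++ x ∷ s) → All (x ≢_) p × All (x ≢_) s
  Unique-focus []      (x∉s ∷ _) = [] , x∉s
  Unique-focus (a ∷ p) (a∉ ∷ u)  with ++⁻ʳ p a∉ | Unique-focus p u
  ... | a≢x ∷ _ | x∉p , x∉s = (a≢x ∘ sym) ∷ x∉p , x∉s

  -- A letter with a smaller left neighbour is followed by a unique longest run of larger letters.
  -- It hops over the run if this is nonempty and is a peak if it is empty.
  upHops+peak : ∀ w → Unique w → upHops w + peak w ≡ asc w
  upHops+peak w uw = begin
    upHops w + peak w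
      ≡⟨ cong (upHops w +_) (sym (∑foci-stat peakψ 0 0 w)) ⟩
    upHops w + ∑foci w (λ p x t → 𝟙 (last 0 p <? val x) * 𝟙 (first 0 t <? val x))
      ≡⟨ sym (∑-+ (foci w) _ _) ⟩
    ∑foci w (λ p x t → ∑splits t (λ q s → hop p x q s) + 𝟙 (last 0 p <? val x) * 𝟙 (first 0 t <? val x))
      ≡⟨ ∑foci-cong w at ⟩
    ∑foci w (λ p x t → 𝟙 (last 0 p <? val x))
      ≡⟨ ∑foci-stat ascψ 0 0 w ⟩
    asc w ∎
    where
    open ≡-Reasoning
    at : ∀ p x t → p ++ x ∷ t ≡ w →
         ∑splits t (λ q s → hop p x q s) + 𝟙 (last 0 p <? val x) * 𝟙 (first 0 t <? val x) ≡ 𝟙 (last 0 p <? val x)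
    at p x t refl = begin
      ∑splits t (λ q s → hop p x q s) + ℓ * 𝟙 (first 0 t <? val x)
        ≡⟨ cong (λ k → ∑splits t (λ q s → hop p x q s) + ℓ * k) (sym (+-identityʳ _)) ⟩
      ∑splits t (λ q s → hop p x q s) + ℓ * F [] t
        ≡⟨ ∑splits-nonempty-left t (λ q s → ℓ * F q s) ⟩
      ∑splits t (λ q s → ℓ * F q s)
        ≡⟨ ∑-*ˡ (splits t) ℓ (uncurry F) ⟩
      ℓ * ∑splits t F
        ≡⟨ cong (ℓ *_) (∑splits-prefix-above x t (proj₂ (Unique-focus p uw))) ⟩
      ℓ * 1
        ≡⟨ *-identityʳ ℓ ⟩
      ℓ ∎
      where
      ℓ = 𝟙 (last 0 p <? val x)
      F : Word → Word → ℕ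
      F q s = 𝟙 (above? x q) * 𝟙 (first 0 s <? val x)

  -- The mirror image: a letter with a smaller right neighbour hops back over the run of larger
  -- letters before it, or is a peak if that run is empty.
  downHops+peak : ∀ w → Unique w → downHops w + peak w ≡ des w
  downHops+peak w uw = begin
    downHops w + peak w
      ≡⟨ cong (downHops w +_) (sym (∑foci-stat peakψ 0 0 w)) ⟩
    downHops w + ∑foci w (λ t x s → 𝟙 (last 0 t <? val x) * 𝟙 (first 0 s <? val x))
      ≡⟨ sym (∑-+ (foci w) _ _) ⟩
    ∑foci w (λ t x s → ∑splits t (λ p q → hop p x q s) + 𝟙 (last 0 t <? val x) * 𝟙 (first 0 s <? val x))
      ≡⟨ ∑foci-cong w at ⟩
    ∑foci w (λ t x s → 𝟙 (first 0 s <? val x))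
      ≡⟨ ∑foci-stat desψ 0 0 w ⟩
    des w ∎
    where
    open ≡-Reasoning
    at : ∀ t x s → t ++ x ∷ s ≡ w →
         ∑splits t (λ p q → hop p x q s) + 𝟙 (last 0 t <? val x) * 𝟙 (first 0 s <? val x) ≡ 𝟙 (first 0 s <? val x)
    at t x s refl = begin
      ∑splits t (λ p q → hop p x q s) + 𝟙 (last 0 t <? val x) * φ
        ≡⟨ cong₂ _+_ (∑-cong (splits t) (λ (p , q) → cong (nonempty q *_) (rearrange (𝟙 (last 0 p <? val x)) (𝟙 (above? x q)) φ)))
                     (cong (_* φ) (sym (*-identityʳ (𝟙 (last 0 t <? val x))))) ⟩
      ∑splits t (λ p q → nonempty q * (φ * F p q)) + F t [] * φ
        ≡⟨ cong (∑splits t (λ p q → nonempty q * (φ * F p q)) +_) (*-comm (F t []) φ) ⟩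
      ∑splits t (λ p q → nonempty q * (φ * F p q)) + φ * F t []
        ≡⟨ ∑splits-nonempty-right t (λ p q → φ * F p q) ⟩
      ∑splits t (λ p q → φ * F p q)
        ≡⟨ ∑-*ˡ (splits t) φ (uncurry F) ⟩
      φ * ∑splits t F
        -- The value before the word is 0, which exceeds no letter, so the correction term of
        -- `∑splits-suffix-above` is 0.
        ≡⟨ cong (φ *_) (trans (sym (+-identityʳ _)) (∑splits-suffix-above x 0 t (λ ()) (proj₁ (Unique-focus t uw)))) ⟩
      φ * 1
        ≡⟨ *-identityʳ φ ⟩
      φ ∎
      where
      φ = 𝟙 (first 0 s <? val x)
      F : Word → Word → ℕ
      F p q = 𝟙 (last 0 p <? val x) * 𝟙 (above? x q)
      rearrange : ∀ i j k → i * (j * k) ≡ k * (i * j)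
      rearrange = solve-∀

  below-last : ∀ (x b : Fin N) q → All (x <·_) (b ∷ q) → val x < last (val b) q
  below-last x b []      (x<b ∷ _) = x<b
  below-last x b (c ∷ q) (_ ∷ x<q) = below-last x c q x<q

  <?-agree : ∀ {k l m} → (k < m → l < m) → (l < m → k < m) → does (k <? m) ≡ does (l <? m)
  <?-agree {k} {l} {m} f g = does-⇔ (mk⇔ f g) (k <? m) (l <? m)

  -- Only `x` changes its comparisons, from smaller left and larger right neighbour to the reverse.
  -- The block lies above `x` and the letters adjoining the whole factor lie below it, so all other
  -- letters compare with their new neighbours as with the old ones.
  stat-hop : ∀ ψ (p : Word) x b q s →
    last 0 p < val x → All (x <·_) (b ∷ q) → first 0 s < val x →
    stat ψ 0 0 (p ++ x ∷ (b ∷ q) ++ s) + ψ false true ≡ stat ψ 0 0 (p ++ (b ∷ q) ++ x ∷ s) + ψ true false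
  stat-hop ψ p x b q s p<x x<q@(x<b ∷ _) s<x = begin
    stat ψ 0 0 (p ++ x ∷ (b ∷ q) ++ s) + ψ false true
      ≡⟨ cong (_+ ψ false true) before ⟩
    Sp + (ψ true false + (Sq + Ss)) + ψ false true
      ≡⟨ shuffle Sp (ψ true false) Sq Ss (ψ false true) ⟩
    Sp + (Sq + (ψ false true + Ss)) + ψ true false
      ≡⟨ cong (_+ ψ true false) (sym after) ⟩
    stat ψ 0 0 (p ++ (b ∷ q) ++ x ∷ s) + ψ true false ∎
    where
    open ≡-Reasoning
    shuffle : ∀ a t b c f → a + (t + (b + c)) + f ≡ a + (b + (f + c)) + t
    shuffle = solve-∀
    x<lq : val x < last (val b) q
    x<lq = below-last x b q x<q
    Sp = stat ψ 0 (val x) p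
    Sq = stat ψ (val x) (first 0 s) (b ∷ q)
    Ss = stat ψ (val x) 0 s
    before : stat ψ 0 0 (p ++ x ∷ (b ∷ q) ++ s) ≡ Sp + (ψ true false + (Sq + Ss))
    before = begin
      stat ψ 0 0 (p ++ x ∷ (b ∷ q) ++ s)
        ≡⟨ stat-++ ψ 0 0 p (x ∷ (b ∷ q) ++ s) ⟩
      Sp + (ψ (does (last 0 p <? val x)) (does (val b <? val x)) + stat ψ (val x) 0 ((b ∷ q) ++ s))
        ≡⟨ cong (Sp +_) (cong₂ _+_ (cong₂ ψ (dec-true (last 0 p <? val x) p<x) (dec-false (val b <? val x) (<-asym x<b)))
             (trans (stat-++ ψ (val x) 0 (b ∷ q) s)
                    (cong (Sq +_) (stat-congˡ ψ (last (val b) q) (val x) 0 s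
                       (<?-agree (λ lq<s → ⊥-elim (<-asym lq<s (<-trans s<x x<lq)))
                                 (λ x<s → ⊥-elim (<-asym x<s s<x))))))) ⟩
      Sp + (ψ true false + (Sq + Ss)) ∎
    after : stat ψ 0 0 (p ++ (b ∷ q) ++ x ∷ s) ≡ Sp + (Sq + (ψ false true + Ss))
    after = begin
      stat ψ 0 0 (p ++ (b ∷ q) ++ x ∷ s)
        ≡⟨ stat-++ ψ 0 0 p ((b ∷ q) ++ x ∷ s) ⟩
      stat ψ 0 (val b) p + stat ψ (last 0 p) 0 ((b ∷ q) ++ x ∷ s)
        ≡⟨ cong₂ _+_
             (stat-congʳ ψ 0 (val b) (val x) p
               (<?-agree (λ b<p → ⊥-elim (<-asym b<p (<-trans p<x x<b)))
                         (λ x<p → ⊥-elim (<-asym x<p p<x))))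
             (stat-++ ψ (last 0 p) 0 (b ∷ q) (x ∷ s)) ⟩
      Sp + (stat ψ (last 0 p) (val x) (b ∷ q)
            + (ψ (does (last (val b) q <? val x)) (does (first 0 s <? val x)) + Ss))
        ≡⟨ cong (Sp +_) (cong₂ _+_
             (trans (stat-congˡ ψ (last 0 p) (val x) (val x) (b ∷ q)
                      (<?-agree (λ _ → x<b) (λ _ → <-trans p<x x<b)))
                    (stat-congʳ ψ (val x) (val x) (first 0 s) (b ∷ q)
                      (<?-agree (λ _ → <-trans s<x x<lq) (λ _ → x<lq))))
             (cong (_+ Ss) (cong₂ ψ (dec-false (last (val b) q <? val x) (<-asym x<lq))
                                   (dec-true (first 0 s <? val x) s<x)))) ⟩
      Sp + (Sq + (ψ false true + Ss)) ∎

  hop-guard : ∀ (p : Word) x q s k l →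
    (∀ b q′ → q ≡ b ∷ q′ → last 0 p < val x → All (x <·_) (b ∷ q′) → first 0 s < val x → k ≤ l) →
    k * hop p x q s ≤ l * hop p x q s
  hop-guard p x []      s k l le = ≤-reflexive (trans (*-zeroʳ k) (sym (*-zeroʳ l)))
  hop-guard p x (b ∷ q) s k l le =
    subst₂ _≤_ (cong (k *_) (sym (+-identityʳ c))) (cong (l *_) (sym (+-identityʳ c)))
      (𝟙-guard-≤ (last 0 p <? val x) k l _ λ p<x → 𝟙-guard-≤ (above? x (b ∷ q)) k l _ λ x<q →
        subst₂ _≤_ (cong (k *_) (*-identityʳ c′)) (cong (l *_) (*-identityʳ c′))
          (𝟙-guard-≤ (first 0 s <? val x) k l 1 λ s<x → *-monoˡ-≤ 1 (le b q refl p<x x<q s<x)))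
    where
    c′ = 𝟙 (first 0 s <? val x)
    c = 𝟙 (last 0 p <? val x) * (𝟙 (above? x (b ∷ q)) * c′)

  ∑foci-∑-*ˡ : ∀ {B : Set} k (w : Word) (G : List (Fin N) → Fin N → List (Fin N) → List B)
    (F : List (Fin N) → Fin N → List (Fin N) → B → ℕ) →
    ∑foci w (λ p x t → ∑ (G p x t) (λ y → k * F p x t y)) ≡ k * ∑foci w (λ p x t → ∑ (G p x t) (F p x t))
  ∑foci-∑-*ˡ k w G F =
    trans (∑-cong (foci w) (λ (p , x , t) → ∑-*ˡ (G p x t) k (F p x t)))
          (∑-*ˡ (foci w) k (λ (p , x , t) → ∑ (G p x t) (F p x t)))

  -- A word with a focus and a split of its tail is the same as a quadruple `p`, `x`, `q`, `s`. Up
  -- and down hops thus become sums over the same quadruples.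
  ∑-words-upHops : ∀ m (f : Word → ℕ) → (∀ w → m < length w → f w ≡ 0) →
    ∑ (words N m) (λ w → f w * upHops w) ≡
    ∑ (words N m) (λ p → ∑ (allFin N) (λ x → ∑ (words N m) (λ q → ∑ (words N m) (λ s →
      f (p ++ x ∷ q ++ s) * hop p x q s))))
  ∑-words-upHops m f supp = begin
    ∑ W (λ w → f w * upHops w)
      ≡⟨ ∑-cong W (λ w → trans (sym (∑foci-∑-*ˡ (f w) w (λ p x t → splits t) (λ p x t → uncurry (hop p x))))
           (∑foci-cong w λ p x t e → ∑splits-cong t {λ q s → f w * hop p x q s} λ q s e′ →
             cong (λ v → f v * hop p x q s) (trans (sym e) (cong (λ v → p ++ x ∷ v) (sym e′))))) ⟩
    ∑ W (λ w → ∑foci w (λ p x t → ∑splits t (F p x)))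
      ≡⟨ ∑-words-foci m (λ p x t → ∑splits t (F p x)) (λ p x t lt → ∑splits-zero t λ q s e →
           vanish p x q s (subst (m <_) (cong (λ k → length p + suc k)
             (trans (cong length (sym e)) (length-++ q))) lt)) ⟩
    ∑ W (λ p → ∑ (allFin N) (λ x → ∑ W (λ t → ∑splits t (F p x))))
      ≡⟨ (∑-cong W λ p → ∑-cong (allFin N) λ x → ∑-words-splits m (F p x) λ q s lt →
            vanish p x q s (≤-trans lt (≤-trans (n≤1+n _) (m≤n+m _ (length p))))) ⟩
    ∑ W (λ p → ∑ (allFin N) (λ x → ∑ W (λ q → ∑ W (F p x q)))) ∎
    where
    open ≡-Reasoning
    W = words N m
    F : Word → Fin N → Word → Word → ℕ
    F p x q s = f (p ++ x ∷ q ++ s) * hop p x q s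
    vanish : ∀ p x q s → m < length p + suc (length q + length s) → F p x q s ≡ 0
    vanish p x q s lt = cong (_* hop p x q s) (supp _ (subst (m <_)
      (sym (trans (length-++ p) (cong (λ k → length p + suc k) (length-++ q)))) lt))

  ∑-words-downHops : ∀ m (f : Word → ℕ) → (∀ w → m < length w → f w ≡ 0) →
    ∑ (words N m) (λ w → f w * downHops w) ≡
    ∑ (words N m) (λ p → ∑ (allFin N) (λ x → ∑ (words N m) (λ q → ∑ (words N m) (λ s →
      f (p ++ q ++ x ∷ s) * hop p x q s))))
  ∑-words-downHops m f supp = begin
    ∑ W (λ w → f w * downHops w)
      ≡⟨ ∑-cong W (λ w → trans (sym (∑foci-∑-*ˡ (f w) w (λ t x s → splits t) (λ t x s → uncurry (λ p q → hop p x q s))))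
           (∑foci-cong w λ t x s e → ∑splits-cong t {λ p q → f w * hop p x q s} λ p q e′ →
             cong (λ v → f v * hop p x q s)
               (trans (sym e) (trans (cong (_++ x ∷ s) (sym e′)) (++-assoc p q (x ∷ s)))))) ⟩
    ∑ W (λ w → ∑foci w (λ t x s → ∑splits t (λ p q → F p x q s)))
      ≡⟨ ∑-words-foci m (λ t x s → ∑splits t (λ p q → F p x q s)) (λ t x s lt → ∑splits-zero t λ p q e →
           vanish p x q s (subst (m <_) (trans (cong (_+ suc (length s)) (trans (cong length (sym e)) (length-++ p)))
              (+-assoc (length p) (length q) (suc (length s)))) lt)) ⟩
    ∑ W (λ t → ∑ (allFin N) (λ x → ∑ W (λ s → ∑splits t (λ p q → F p x q s))))
      -- Here the split prefix `t` comes before `x` and `s`, so interchanges are needed to reach the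
      -- order `p`, `x`, `q`, `s`.
      ≡⟨ ∑-comm W (allFin N) (λ t x → ∑ W (λ s → ∑splits t (λ p q → F p x q s))) ⟩
    ∑ (allFin N) (λ x → ∑ W (λ t → ∑ W (λ s → ∑splits t (λ p q → F p x q s))))
      ≡⟨ (∑-cong (allFin N) λ x → ∑-comm W W (λ t s → ∑splits t (λ p q → F p x q s))) ⟩
    ∑ (allFin N) (λ x → ∑ W (λ s → ∑ W (λ t → ∑splits t (λ p q → F p x q s))))
      ≡⟨ (∑-cong (allFin N) λ x → ∑-cong W λ s → ∑-words-splits m (λ p q → F p x q s) λ p q lt →
            vanish p x q s (≤-trans lt (+-monoʳ-≤ (length p) (m≤m+n (length q) (suc (length s)))))) ⟩
    ∑ (allFin N) (λ x → ∑ W (λ s → ∑ W (λ p → ∑ W (λ q → F p x q s))))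
      ≡⟨ (∑-cong (allFin N) λ x → ∑-comm W W (λ s p → ∑ W (λ q → F p x q s))) ⟩
    ∑ (allFin N) (λ x → ∑ W (λ p → ∑ W (λ s → ∑ W (λ q → F p x q s))))
      ≡⟨ (∑-cong (allFin N) λ x → ∑-cong W λ p → ∑-comm W W (λ s q → F p x q s)) ⟩
    ∑ (allFin N) (λ x → ∑ W (λ p → ∑ W (λ q → ∑ W (λ s → F p x q s))))
      ≡⟨ ∑-comm (allFin N) W (λ x p → ∑ W (λ q → ∑ W (λ s → F p x q s))) ⟩
    ∑ W (λ p → ∑ (allFin N) (λ x → ∑ W (λ q → ∑ W (F p x q)))) ∎
    where
    open ≡-Reasoning
    W = words N m
    F : Word → Fin N → Word → Word → ℕ
    F p x q s = f (p ++ q ++ x ∷ s) * hop p x q s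
    vanish : ∀ p x q s → m < length p + (length q + suc (length s)) → F p x q s ≡ 0
    vanish p x q s lt = cong (_* hop p x q s) (supp _ (subst (m <_)
      (sym (trans (length-++ p) (cong (length p +_) (length-++ q)))) lt))

-- Normalized matching

factor-cancel : ∀ a b x y → b ≤ a → .{{NonZero b}} → a * x ≤ b * y → x ≤ y
factor-cancel a b x y b≤a le = *-cancelˡ-≤ b (≤-trans (*-monoˡ-≤ x b≤a) le)

module _ (m : ℕ) (H : ℕ → ℕ) (grow : ∀ d → d < m → (m ∸ d) * H d ≤ suc d * H (suc d)) where

  -- Since `d ! * (m ∸ d) !` is `m !` divided by C(m, d), this is the monotonicity of H(d) / C(m, d)
  -- with denominators cleared.
  normalized-step : ∀ d → d < m → d ! * (m ∸ d) ! * H d ≤ suc d ! * (m ∸ suc d) ! * H (suc d)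
  normalized-step d d<m = begin
    d ! * (m ∸ d) ! * H d
      ≡⟨ cong (λ k → d ! * k ! * H d) m∸d ⟩
    d ! * (suc (m ∸ suc d) * (m ∸ suc d) !) * H d
      ≡⟨ shuffle (d !) (suc (m ∸ suc d)) ((m ∸ suc d) !) (H d) ⟩
    d ! * (m ∸ suc d) ! * (suc (m ∸ suc d) * H d)
      ≡⟨ cong (λ k → d ! * (m ∸ suc d) ! * (k * H d)) (sym m∸d) ⟩
    d ! * (m ∸ suc d) ! * ((m ∸ d) * H d)
      ≤⟨ *-monoʳ-≤ (d ! * (m ∸ suc d) !) (grow d d<m) ⟩
    d ! * (m ∸ suc d) ! * (suc d * H (suc d))
      ≡⟨ shuffle′ (d !) ((m ∸ suc d) !) (suc d) (H (suc d)) ⟩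
    suc d ! * (m ∸ suc d) ! * H (suc d) ∎
    where
    open ≤-Reasoning
    m∸d : m ∸ d ≡ suc (m ∸ suc d)
    m∸d = +-∸-assoc 1 d<m
    shuffle : ∀ a b c h → a * (b * c) * h ≡ a * c * (b * h)
    shuffle = solve-∀
    shuffle′ : ∀ a c b h → a * c * (b * h) ≡ b * a * c * h
    shuffle′ = solve-∀

  normalized-mono : ∀ d k → d + k ≤ m → d ! * (m ∸ d) ! * H d ≤ (d + k) ! * (m ∸ (d + k)) ! * H (d + k)
  normalized-mono d zero    le rewrite +-identityʳ d = ≤-refl
  normalized-mono d (suc k) le rewrite +-suc d k =
    ≤-trans (normalized-mono d k (≤-trans (n≤1+n _) le)) (normalized-step (d + k) le)

  -- The levels `d` and `m ∸ d` carry the same normalizing factor, which cancels after climbing from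
  -- one to the other.
  H-reflect : ∀ d → 2 * d ≤ m → H d ≤ H (m ∸ d)
  H-reflect d 2d≤m = *-cancelˡ-≤ (d ! * (m ∸ d) !) {{m*n≢0 (d !) ((m ∸ d) !) {{d !≢0}} {{(m ∸ d) !≢0}}}} (begin
    d ! * (m ∸ d) ! * H d
      ≤⟨ normalized-mono d (m ∸ d ∸ d) (≤-trans (≤-reflexive d+) (m∸n≤m m d)) ⟩
    (d + (m ∸ d ∸ d)) ! * (m ∸ (d + (m ∸ d ∸ d))) ! * H (d + (m ∸ d ∸ d))
      ≡⟨ cong (λ k → k ! * (m ∸ k) ! * H k) d+ ⟩
    (m ∸ d) ! * (m ∸ (m ∸ d)) ! * H (m ∸ d)
      ≡⟨ cong (λ k → (m ∸ d) ! * k ! * H (m ∸ d)) (m∸[m∸n]≡n (≤-trans (m≤m+n d (d + 0)) 2d≤m)) ⟩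
    (m ∸ d) ! * d ! * H (m ∸ d)
      ≡⟨ cong (_* H (m ∸ d)) (*-comm ((m ∸ d) !) (d !)) ⟩
    d ! * (m ∸ d) ! * H (m ∸ d) ∎)
    where
    open ≤-Reasoning
    d≤m∸d : d ≤ m ∸ d
    d≤m∸d = m+n≤o⇒m≤o∸n d (subst (_≤ m) (cong (d +_) (+-identityʳ d)) 2d≤m)
    d+ : d + (m ∸ d ∸ d) ≡ m ∸ d
    d+ = m+[n∸m]≡n d≤m∸d

  -- Below the middle the factor `m ∸ d` in `grow` is at least the factor `suc d`.
  H-ascend : ∀ d → suc (d + d) ≤ m → H d ≤ H (suc d)
  H-ascend d le = factor-cancel (m ∸ d) (suc d) (H d) (H (suc d)) (m+n≤o⇒m≤o∸n (suc d) le)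
    (grow d (≤-trans (s≤s (m≤m+n d d)) le))

-- Words closed under replacing ascents by descents

module SwapClosed
  {N : ℕ} (r : ℕ) (P : List (Fin N) → Set) (P? : ∀ w → Dec (P w))
  (P-length : ∀ {w} → P w → length w ≡ suc r)
  (P-unique : ∀ {w} → P w → Unique w)
  (P-swap : ∀ p {a b s} → val a < val b → P (p ++ a ∷ b ∷ s) → P (p ++ b ∷ a ∷ s))
  where

  private
    W : List (List (Fin N))
    W = words N (suc r)

  -- The letter `x` moves right one position at a time, and each move turns an ascent into a descent
  -- because the letters of `q` are above `x`.
  P-slide : ∀ p x q s → All (x <·_) q → P (p ++ x ∷ q ++ s) → P (p ++ q ++ x ∷ s)
  P-slide p x []      s []          pw = pw
  P-slide p x (b ∷ q) s (x<b ∷ x<q) pw =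
    subst P (++-assoc p (b ∷ []) (q ++ x ∷ s))
      (P-slide (p ++ b ∷ []) x q s x<q
        (subst P (sym (++-assoc p (b ∷ []) (x ∷ q ++ s))) (P-swap p x<b pw)))

  Stratum : ℕ → ℕ → List (Fin N) → Set
  Stratum e c w = P w × des w ≡ e × peak w ≡ c

  stratum? : ∀ e c w → Dec (Stratum e c w)
  stratum? e c w = P? w ×-dec (des w ≟ e ×-dec peak w ≟ c)

  #stratum : ℕ → ℕ → ℕ
  #stratum e c = ∑ W (λ w → 𝟙 (stratum? e c w))

  stratum-support : ∀ e c w → suc r < length w → 𝟙 (stratum? e c w) ≡ 0
  stratum-support e c w lt = 𝟙-no (stratum? e c w) (λ (pw , _) → <-irrefl (sym (P-length pw)) lt)

  -- A hop stays in the family by `P-slide`; `stat-hop` for `desψ` and `peakψ` shows that it adds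
  -- one descent and preserves the number of peaks.
  stratum-hop : ∀ e c p x q s →
    𝟙 (stratum? e c (p ++ x ∷ q ++ s)) * hop p x q s ≤ 𝟙 (stratum? (suc e) c (p ++ q ++ x ∷ s)) * hop p x q s
  stratum-hop e c p x q s = hop-guard p x q s
    (𝟙 (stratum? e c (p ++ x ∷ q ++ s))) (𝟙 (stratum? (suc e) c (p ++ q ++ x ∷ s))) λ { b q′ refl p<x x<q s<x →
    𝟙-mono (stratum? e c (p ++ x ∷ q ++ s)) (stratum? (suc e) c (p ++ q ++ x ∷ s)) λ (pw , de , pe) →
      P-slide p x q s x<q pw ,
      trans (sym (trans (stat-hop desψ p x b q′ s p<x x<q s<x) (+-identityʳ _)))
            (trans (+-comm (des (p ++ x ∷ q ++ s)) 1) (cong suc de)) ,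
      trans (sym (+-cancelʳ-≡ 0 _ _ (stat-hop peakψ p x b q′ s p<x x<q s<x))) pe }

  upHops-stratum : ∀ {e c} w → Stratum e c w → upHops w ≡ 2 + r ∸ (e + c)
  upHops-stratum [] (pw , _) = ⊥-elim (0≢1+n (P-length pw))
  upHops-stratum (a ∷ w) (pw , refl , refl) = sym (begin
    2 + r ∸ (D + K)                ≡⟨ cong (λ k → suc k ∸ (D + K)) (sym (P-length pw)) ⟩
    suc (length (a ∷ w)) ∸ (D + K) ≡⟨ cong (_∸ (D + K)) (sym (asc+des a w uw)) ⟩
    asc (a ∷ w) + D ∸ (D + K)      ≡⟨ cong (λ k → k + D ∸ (D + K)) (sym (upHops+peak (a ∷ w) uw)) ⟩
    U + K + D ∸ (D + K)            ≡⟨ cong (_∸ (D + K)) (trans (+-assoc U K D) (cong (U +_) (+-comm K D))) ⟩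
    U + (D + K) ∸ (D + K)          ≡⟨ m+n∸n≡m U (D + K) ⟩
    U ∎)
    where
    open ≡-Reasoning
    uw = P-unique pw
    D = des (a ∷ w)
    K = peak (a ∷ w)
    U = upHops (a ∷ w)

  downHops-stratum : ∀ {e c} w → Stratum e c w → downHops w ≡ e ∸ c
  downHops-stratum w (pw , refl , refl) =
    trans (sym (m+n∸n≡m (downHops w) (peak w))) (cong (_∸ peak w) (downHops+peak w (P-unique pw)))

  double-count : ∀ e c → (2 + r ∸ (e + c)) * #stratum e c ≤ (suc e ∸ c) * #stratum (suc e) c
  double-count e c = begin
    (2 + r ∸ (e + c)) * #stratum e c
      ≡⟨ sym (∑-*ˡ W (2 + r ∸ (e + c)) (λ w → 𝟙 (stratum? e c w))) ⟩
    ∑ W (λ w → (2 + r ∸ (e + c)) * 𝟙 (stratum? e c w))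
      ≡⟨ (∑-cong W λ w → trans (*-comm _ (𝟙 (stratum? e c w)))
           (𝟙-guard (stratum? e c w) (sym ∘ upHops-stratum w))) ⟩
    ∑ W (λ w → 𝟙 (stratum? e c w) * upHops w)
      ≡⟨ ∑-words-upHops (suc r) _ (stratum-support e c) ⟩
    ∑ W (λ p → ∑ (allFin N) (λ x → ∑ W (λ q → ∑ W (λ s → 𝟙 (stratum? e c (p ++ x ∷ q ++ s)) * hop p x q s))))
      -- The only inequality: every up hop leads into the next stratum, whereas a down hop from
      -- there may leave the family.
      ≤⟨ (∑-mono W λ p → ∑-mono (allFin N) λ x → ∑-mono W λ q → ∑-mono W λ s → stratum-hop e c p x q s) ⟩
    ∑ W (λ p → ∑ (allFin N) (λ x → ∑ W (λ q → ∑ W (λ s → 𝟙 (stratum? (suc e) c (p ++ q ++ x ∷ s)) * hop p x q s))))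
      ≡⟨ sym (∑-words-downHops (suc r) _ (stratum-support (suc e) c)) ⟩
    ∑ W (λ w → 𝟙 (stratum? (suc e) c w) * downHops w)
      ≡⟨ (∑-cong W λ w → trans (𝟙-guard (stratum? (suc e) c w) (downHops-stratum w))
           (*-comm (𝟙 (stratum? (suc e) c w)) _)) ⟩
    ∑ W (λ w → (suc e ∸ c) * 𝟙 (stratum? (suc e) c w))
      ≡⟨ ∑-*ˡ W (suc e ∸ c) (λ w → 𝟙 (stratum? (suc e) c w)) ⟩
    (suc e ∸ c) * #stratum (suc e) c ∎
    where open ≤-Reasoning

  #stratum-empty : ∀ {e c} → e < c → #stratum e c ≡ 0
  #stratum-empty {e} {c} e<c = ∑-zero W λ w → 𝟙-no (stratum? e c w)
    λ { (_ , refl , refl) → <-irrefl refl (<-≤-trans e<c (peak≤des w)) }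

  -- With c peaks fixed, the number of descents varies over the ranks of Boolean lattices of rank 2 + r - 2c.
  module _ (c : ℕ) where

    private
      m = 2 + r ∸ (c + c)
      H : ℕ → ℕ
      H d = #stratum (c + d) c

    stratum-grow : ∀ d → d < m → (m ∸ d) * H d ≤ suc d * H (suc d)
    stratum-grow d _ = subst₂ _≤_ (cong (_* H d) lhs) rhs (double-count (c + d) c)
      where
      lhs : 2 + r ∸ (c + d + c) ≡ m ∸ d
      lhs = trans (cong (2 + r ∸_) (shuffle c d)) (sym (∸-+-assoc (2 + r) (c + c) d))
        where
        shuffle : ∀ c d → c + d + c ≡ c + c + d
        shuffle = solve-∀
      rhs : (suc (c + d) ∸ c) * #stratum (suc (c + d)) c ≡ suc d * H (suc d)
      rhs = cong₂ (λ k l → k * #stratum l c)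
                  (trans (cong (_∸ c) (sym (+-suc c d))) (m+n∸m≡n c (suc d))) (sym (+-suc c d))

    -- With e = c + d the hypothesis becomes 2d + 1 ≤ m, so level `d` lies below the middle. For e <
    -- c the stratum is empty.
    stratum-ascend : ∀ e → 2 * e ≤ suc r → #stratum e c ≤ #stratum (suc e) c
    stratum-ascend e le with ≤-<-connex c e
    ... | inj₂ e<c = subst (_≤ #stratum (suc e) c) (sym (#stratum-empty e<c)) z≤n
    ... | inj₁ c≤e with e ∸ c | m+[n∸m]≡n c≤e
    ... | d | refl = subst (H d ≤_) (cong (λ k → #stratum k c) (+-suc c d))
      (H-ascend m H stratum-grow d (m+n≤o⇒m≤o∸n (suc (d + d))
        (≤-trans (≤-reflexive (shuffle c d)) (s≤s le))))
      where
      shuffle : ∀ c d → suc (d + d) + (c + c) ≡ suc (2 * (c + d))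
      shuffle = solve-∀

    -- The reflection of `d` in `m` takes e = c + d to r + 2 - e whatever `c` is, so the
    -- inequalities for all `c` can be added up.
    stratum-reflect : ∀ e → 2 * e ≤ 2 + r → #stratum e c ≤ #stratum (2 + r ∸ e) c
    stratum-reflect e le with ≤-<-connex c e
    ... | inj₂ e<c = subst (_≤ #stratum (2 + r ∸ e) c) (sym (#stratum-empty e<c)) z≤n
    ... | inj₁ c≤e with e ∸ c | m+[n∸m]≡n c≤e
    ... | d | refl = subst (H d ≤_) (cong (λ k → #stratum k c) index)
      (H-reflect m H stratum-grow d (m+n≤o⇒m≤o∸n (2 * d)
        (≤-trans (≤-reflexive (shuffle c d)) le)))
      where
      shuffle : ∀ c d → 2 * d + (c + c) ≡ 2 * (c + d)
      shuffle = solve-∀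
      shuffle′ : ∀ c d → c + (c + d) + d ≡ 2 * (c + d)
      shuffle′ = solve-∀
      index : c + (m ∸ d) ≡ 2 + r ∸ (c + d)
      index = begin
        c + (2 + r ∸ (c + c) ∸ d)   ≡⟨ cong (c +_) (trans (∸-+-assoc (2 + r) (c + c) d) (cong (2 + r ∸_) (+-assoc c c d))) ⟩
        c + (2 + r ∸ (c + (c + d))) ≡⟨ sym (+-∸-assoc c {2 + r} {c + (c + d)} (≤-trans (m≤m+n (c + (c + d)) d) (≤-trans (≤-reflexive (shuffle′ c d)) le))) ⟩
        c + (2 + r) ∸ (c + (c + d)) ≡⟨ [m+n]∸[m+o]≡n∸o c (2 + r) (c + d) ⟩
        2 + r ∸ (c + d) ∎
        where open ≡-Reasoning

  #des : ℕ → ℕ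
  #des e = ∑ W (λ w → 𝟙 (P? w) * 𝟙 (des w ≟ e))

  -- A word has at most as many peaks as descents, so every range beyond `e` captures all strata.
  -- Leaving `B` free allows two descent numbers to share one range.
  #des-strata : ∀ e B → e < B → #des e ≡ ∑ (upTo B) (#stratum e)
  #des-strata e B e<B =
    trans (∑-cong W (λ w → trans (sym (𝟙-× (P? w) (des w ≟ e))) (sym (one w))))
          (∑-comm W (upTo B) (λ w c → 𝟙 (stratum? e c w)))
    where
    one : ∀ w → ∑ (upTo B) (λ c → 𝟙 (stratum? e c w)) ≡ 𝟙 (P? w ×-dec des w ≟ e)
    one w = go (P? w ×-dec des w ≟ e)
      where
      go : (d : Dec (P w × des w ≡ e)) → ∑ (upTo B) (λ c → 𝟙 (stratum? e c w)) ≡ 𝟙 d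
      go (no ¬pd) = ∑-zero (upTo B) (λ c → 𝟙-no (stratum? e c w) (λ (pw , de , _) → ¬pd (pw , de)))
      go (yes (pw , de)) = trans
        (∑-single {m = peak w} (upTo B) _ (upTo⁺ B) (∈-upTo⁺ (≤-<-trans (≤-trans (peak≤des w) (≤-reflexive de)) e<B))
          (λ c c≢ → 𝟙-no (stratum? e c w) (λ (_ , _ , pe) → c≢ (sym pe))))
        (𝟙-yes (stratum? e (peak w) w) (pw , de , refl))

  #des-ascend : ∀ e → 2 * e ≤ suc r → #des e ≤ #des (suc e)
  #des-ascend e le = subst₂ _≤_ (sym (#des-strata e B (s≤s (n≤1+n e)))) (sym (#des-strata (suc e) B ≤-refl))
    (∑-mono (upTo B) λ c → stratum-ascend c e le)
    where B = 2 + e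

  #des-reflect : ∀ e → 2 * e ≤ 2 + r → #des e ≤ #des (2 + r ∸ e)
  #des-reflect e le =
    subst₂ _≤_ (sym (#des-strata e B (s≤s (m≤m+n e _)))) (sym (#des-strata (2 + r ∸ e) B (s≤s (m≤n+m _ e))))
      (∑-mono (upTo B) λ c → stratum-reflect c e le)
    where B = suc (e + (2 + r ∸ e))

-- The transformation from f-vectors to h-vectors

hTerm : ℕ → (ℕ → ℕ) → ℕ → ℕ → ℤ
hTerm r f k j = signPow (k ∸ j) ℤ.* (pos ((r ∸ j) C (k ∸ j))) ℤ.* (pos f j)

-- The shape of `hvecAux` for an arbitrary sequence `f`, so that linearity in `f` is available.
hPartial : ℕ → (ℕ → ℕ) → ℕ → ℕ → ℤ
hPartial r f k zero    = hTerm r f k 0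
hPartial r f k (suc m) = hPartial r f k m ℤ.+ hTerm r f k (suc m)

hTransform : ℕ → (ℕ → ℕ) → ℕ → ℤ
hTransform r f k = hPartial r f k k

hPartial-cong : ∀ r {f g} k m → (∀ j → f j ≡ g j) → hPartial r f k m ≡ hPartial r g k m
hPartial-cong r k zero    eq = cong (λ c → signPow k ℤ.* (pos (r C k)) ℤ.* (pos c)) (eq 0)
hPartial-cong r k (suc m) eq = cong₂ ℤ._+_ (hPartial-cong r k m eq)
  (cong (λ c → signPow (k ∸ suc m) ℤ.* (pos ((r ∸ suc m) C (k ∸ suc m))) ℤ.* (pos c)) (eq (suc m)))

hTerm-+ : ∀ r f g k j → hTerm r (λ j → f j + g j) k j ≡ hTerm r f k j ℤ.+ hTerm r g k j
hTerm-+ r f g k j = trans (cong (c ℤ.*_) (ℤ.pos-+ (f j) (g j))) (ℤ.*-distribˡ-+ c (pos f j) (pos g j))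
  where c = signPow (k ∸ j) ℤ.* (pos ((r ∸ j) C (k ∸ j)))

ℤ-interchange : ∀ a b c d → (a ℤ.+ b) ℤ.+ (c ℤ.+ d) ≡ (a ℤ.+ c) ℤ.+ (b ℤ.+ d)
ℤ-interchange = ℤ-Solver.solve-∀

hPartial-+ : ∀ r f g k m → hPartial r (λ j → f j + g j) k m ≡ hPartial r f k m ℤ.+ hPartial r g k m
hPartial-+ r f g k zero    = hTerm-+ r f g k 0
hPartial-+ r f g k (suc m) =
  trans (cong₂ ℤ._+_ (hPartial-+ r f g k m) (hTerm-+ r f g k (suc m)))
        (ℤ-interchange (hPartial r f k m) (hPartial r g k m) (hTerm r f k (suc m)) (hTerm r g k (suc m)))

hTerm-0 : ∀ r f k j → f j ≡ 0 → hTerm r f k j ≡ pos 0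
hTerm-0 r f k j eq = trans (cong (λ x → c ℤ.* (pos x)) eq) (ℤ.*-zeroʳ c)
  where c = signPow (k ∸ j) ℤ.* (pos ((r ∸ j) C (k ∸ j)))

hPartial-0 : ∀ r f k m → (∀ j → f j ≡ 0) → hPartial r f k m ≡ pos 0
hPartial-0 r f k zero    eq = hTerm-0 r f k 0 (eq 0)
hPartial-0 r f k (suc m) eq = cong₂ ℤ._+_ (hPartial-0 r f k m eq) (hTerm-0 r f k (suc m) (eq (suc m)))

-- Linearity, which reduces the transform of a sum over label words to that of a single word.
hTransform-∑ : ∀ {A : Set} r k (xs : List A) (f : A → ℕ → ℕ) (h : A → ℕ) →
  (∀ x → hTransform r (f x) k ≡ pos h x) → hTransform r (λ j → ∑ xs (λ x → f x j)) k ≡ pos ∑ xs h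
hTransform-∑ r k []       f h eq = hPartial-0 r _ k k (λ _ → refl)
hTransform-∑ r k (x ∷ xs) f h eq =
  trans (hPartial-+ r (f x) (λ j → ∑ xs (λ x → f x j)) k k)
        (trans (cong₂ ℤ._+_ (eq x) (hTransform-∑ r k xs f h eq)) (sym (ℤ.pos-+ (h x) (∑ xs h))))

shift : (ℕ → ℕ) → ℕ → ℕ
shift g zero    = 0
shift g (suc j) = g j

-- Raising both `r` and the indices of `g` by one leaves the polynomial Σ g_j (x-1)^(r-j) unchanged.
hPartial-shift : ∀ r g k m → hPartial (suc r) (shift g) (suc k) (suc m) ≡ hPartial r g k m
hPartial-shift r g k zero    =
  trans (cong (ℤ._+ hTerm r g k 0) (hTerm-0 (suc r) (shift g) (suc k) 0 refl)) (ℤ.+-identityˡ _)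
hPartial-shift r g k (suc m) = cong (ℤ._+ hTerm r g k (suc m)) (hPartial-shift r g k m)

-- Pascal's rule for C(r - j + 1, k - j + 1). For j > r the truncated differences `suc r ∸ j` and
-- `r ∸ j` are both 0 and the rule can fail, so `g j` has to vanish there.
hTerm-Pascal : ∀ r g k j → j ≤ k → (r < j → g j ≡ 0) →
  hTerm (suc r) g (suc k) j ℤ.+ hTerm r g k j ≡ hTerm r g (suc k) j
hTerm-Pascal r g k j j≤k supp with ≤-<-connex j r
... | inj₂ r<j = trans (cong₂ ℤ._+_ (hTerm-0 (suc r) g (suc k) j (supp r<j)) (hTerm-0 r g k j (supp r<j)))
                       (sym (hTerm-0 r g (suc k) j (supp r<j)))
... | inj₁ j≤r rewrite +-∸-assoc 1 j≤r | +-∸-assoc 1 j≤k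
             | sym (nCk+nC[k+1]≡[n+1]C[k+1] (r ∸ j) (k ∸ j))
             | ℤ.pos-+ ((r ∸ j) C (k ∸ j)) ((r ∸ j) C suc (k ∸ j)) =
  identity (signPow (k ∸ j)) (pos ((r ∸ j) C (k ∸ j))) (pos ((r ∸ j) C suc (k ∸ j))) (pos g j)
  where
  identity : ∀ s a b c → (ℤ.- s) ℤ.* (a ℤ.+ b) ℤ.* c ℤ.+ s ℤ.* a ℤ.* c ≡ (ℤ.- s) ℤ.* b ℤ.* c
  identity = ℤ-Solver.solve-∀

hPartial-Pascal : ∀ r g k m → m ≤ k → (∀ j → r < j → g j ≡ 0) →
  hPartial (suc r) g (suc k) m ℤ.+ hPartial r g k m ≡ hPartial r g (suc k) m
hPartial-Pascal r g k zero    _   supp = hTerm-Pascal r g k 0 z≤n (supp 0)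
hPartial-Pascal r g k (suc m) m<k supp =
  trans (ℤ-interchange (hPartial (suc r) g (suc k) m) (hTerm (suc r) g (suc k) (suc m))
                       (hPartial r g k m) (hTerm r g k (suc m)))
        (cong₂ ℤ._+_ (hPartial-Pascal r g k m (≤-trans (n≤1+n m) m<k) supp)
                     (hTerm-Pascal r g k (suc m) m<k (supp (suc m))))

-- Raising `r` by one multiplies Σ g_j (x-1)^(r-j) by x - 1; the identity compares coefficients of
-- x^(r-k).
hTransform-Pascal : ∀ r g k → (∀ j → r < j → g j ≡ 0) →
  hTransform (suc r) g (suc k) ℤ.+ hTransform r g k ≡ hTransform r g (suc k)
hTransform-Pascal r g k supp =
  trans (swap (hPartial (suc r) g (suc k) k) (hTerm (suc r) g (suc k) (suc k)) (hPartial r g k k))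
        (cong₂ ℤ._+_ (hPartial-Pascal r g k k ≤-refl supp) last-term)
  where
  swap : ∀ a b c → a ℤ.+ b ℤ.+ c ≡ a ℤ.+ c ℤ.+ b
  swap = ℤ-Solver.solve-∀
  -- The term j = k + 1 has no partner in the transform at `k`; its binomial coefficient is 1 for
  -- both `r` and `suc r`.
  last-term : hTerm (suc r) g (suc k) (suc k) ≡ hTerm r g (suc k) (suc k)
  last-term rewrite n∸n≡0 k = refl

module _ {N : ℕ} where

  -- The number of j-element sets of interior positions of w that contain all descents of w.
  markings : List (Fin N) → ℕ → ℕ
  markings []      j       = 0
  markings (b ∷ w) zero    = 1 ∸ nonempty w + 𝟙 (val b ≤? first 0 w) * markings w 0
  markings (b ∷ w) (suc j) = markings w j + 𝟙 (val b ≤? first 0 w) * markings w (suc j)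

  markings-support : ∀ w j → length w ≤ j → markings w j ≡ 0
  markings-support []      j       _        = refl
  markings-support (b ∷ w) (suc j) (s≤s le)
    rewrite markings-support w j le | markings-support w (suc j) (≤-trans le (n≤1+n j)) =
      *-zeroʳ (𝟙 (val b ≤? first 0 w))

  stat-des-positive : ∀ d a (w : List (Fin N)) → 1 ≤ stat desψ d 0 (a ∷ w)
  stat-des-positive d a []      = s≤s z≤n
  stat-des-positive d a (b ∷ w) = ≤-trans (stat-des-positive (val a) b w) (m≤n+m _ (𝟙 (val b <? val a)))

  -- The coefficient of x^(r-k) in Σ_{S ⊇ Des w} (x-1)^(r-|S|) = x^(r-|Des w|).
  hTransform-markings : ∀ r k d (w : List (Fin N)) → length w ≡ suc r →
    hTransform r (markings w) k ≡ pos 𝟙 (stat desψ d 0 w ≟ suc k)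
  hTransform-markings r       k d []      ()
  hTransform-markings zero    k d (b ∷ []) refl = go k
    where
    go : ∀ k → hTransform 0 (markings (b ∷ [])) k ≡ pos 𝟙 (1 ≟ suc k)
    go zero    = refl
    go (suc k) = prefix (suc k)
      where
      zero-after : ∀ j → markings (b ∷ []) (suc j) ≡ 0
      zero-after j = *-zeroʳ (𝟙 (val b ≤? 0))
      prefix : ∀ m → hPartial 0 (markings (b ∷ [])) (suc k) m ≡ pos 0
      prefix zero    = trans (cong (ℤ._* (pos markings (b ∷ []) 0)) (ℤ.*-zeroʳ (signPow (suc k)))) refl
      prefix (suc m) = cong₂ ℤ._+_ (prefix m) (hTerm-0 0 (markings (b ∷ [])) (suc k) (suc m) (zero-after m))
  hTransform-markings (suc r) k d (b ∷ w@(c ∷ w′)) len = step k (val c <? val b)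
    where
    g = markings w
    D = stat desψ (val b) 0 w
    supp : ∀ j → r < j → g j ≡ 0
    supp j lt = markings-support w j (subst (_≤ j) (sym (suc-injective len)) lt)
    IH : ∀ k → hTransform r g k ≡ pos 𝟙 (D ≟ suc k)
    IH k = hTransform-markings r k (val b) w (suc-injective len)

    -- A descent forces the position behind `b` to be marked, which leaves one mark fewer for `w`.
    descent : val c < val b → ∀ j → markings (b ∷ w) j ≡ shift g j
    descent c<b zero    = cong (_* g 0) (𝟙-no (val b ≤? val c) (<⇒≱ c<b))
    descent c<b (suc j) = trans (cong (λ e → g j + e * g (suc j)) (𝟙-no (val b ≤? val c) (<⇒≱ c<b))) (+-identityʳ _)

    -- At an ascent the position behind `b` may be marked or not.
    ascent : ¬ val c < val b → ∀ j → markings (b ∷ w) j ≡ shift g j + g j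
    ascent c≮b zero    = trans (cong (_* g 0) (𝟙-yes (val b ≤? val c) (≮⇒≥ c≮b))) (+-identityʳ _)
    ascent c≮b (suc j) = cong (g j +_)
      (trans (cong (_* g (suc j)) (𝟙-yes (val b ≤? val c) (≮⇒≥ c≮b))) (+-identityʳ _))

    step : ∀ k → Dec (val c < val b) →
      hTransform (suc r) (markings (b ∷ w)) k ≡ pos 𝟙 (𝟙 (val c <? val b) + D ≟ suc k)
    -- The descents at `b` and at the end exclude the count 1, and `shift g` starts with 0.
    step zero (yes c<b) = trans (hPartial-cong (suc r) 0 0 (descent c<b))
      (sym (cong pos_ (𝟙-no (_ ≟ 1) λ eq → 1+n≰n (subst (1 ≤_)
        (suc-injective (trans (cong (_+ D) (sym (𝟙-yes (val c <? val b) c<b))) eq))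
        (stat-des-positive (val b) c w′)))))
    step (suc k) (yes c<b) =
      trans (hPartial-cong (suc r) (suc k) (suc k) (descent c<b))
      (trans (hPartial-shift r g k k)
      (trans (IH k) (cong (λ e → pos 𝟙 (e + D ≟ suc (suc k))) (sym (𝟙-yes (val c <? val b) c<b)))))
    step zero (no c≮b) =
      trans (hPartial-cong (suc r) 0 0 (ascent c≮b))
      (trans (IH 0) (cong (λ e → pos 𝟙 (e + D ≟ 1)) (sym (𝟙-no (val c <? val b) c≮b))))
    -- Coefficient `k` from the marked case and coefficient `suc k` from the unmarked case combine
    -- by the Pascal identity.
    step (suc k) (no c≮b) =
      trans (hPartial-cong (suc r) (suc k) (suc k) (ascent c≮b))
      (trans (hPartial-+ (suc r) (shift g) g (suc k) (suc k))
      (trans (cong (ℤ._+ hTransform (suc r) g (suc k)) (hPartial-shift r g k k))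
      (trans (ℤ.+-comm (hTransform r g k) (hTransform (suc r) g (suc k)))
      (trans (hTransform-Pascal r g k supp)
      (trans (IH (suc k)) (cong (λ e → pos 𝟙 (e + D ≟ suc (suc k))) (sym (𝟙-no (val c <? val b) c≮b))))))))

-- Label words of maximal chains

minimal-element : ∀ {n} {_≺_ : Fin n → Fin n → Set} {P : Fin n → Set} → WellFounded _≺_ →
  Decidable₂ _≺_ → Decidable P → ∀ y → P y → ∃ λ m → P m × ∀ z → P z → ¬ z ≺ m
minimal-element {_≺_ = _≺_} {P} wf _≺?_ P? y py = search y py (wf y)
  where
  search : ∀ y → P y → Acc _≺_ y → ∃ λ m → P m × ∀ z → P z → ¬ z ≺ m
  search y py (acc rs) with any? (λ z → P? z ×-dec (z ≺? y))
  ... | yes (z , pz , z≺y) = search z pz (rs z≺y)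
  ... | no none = y , py , λ z pz z≺y → none (z , pz , z≺y)

∑-words-[] : ∀ {N} m (g : List (Fin N) → ℕ) → (∀ a w → g (a ∷ w) ≡ 0) → ∑ (words N m) g ≡ g []
∑-words-[] zero    g eq = +-identityʳ (g [])
∑-words-[] {N} (suc m) g eq =
  trans (∑-words-suc m g)
        (trans (cong (g [] +_) (∑-zero (allFin N) (λ a → ∑-zero (words N m) (eq a)))) (+-identityʳ (g [])))

module Labelling (L : GeometricLattice) where

  open GeometricLattice L public
    renaming (n to N; _≤_ to _⊑_; _≤?_ to _⊑?_)
  open IsPartialOrder isPartialOrder public
    using () renaming (refl to ⊑-refl; trans to ⊑-trans; antisym to ⊑-antisym)

  _⊏_ : Fin N → Fin N → Set
  x ⊏ y = x ⊑ y × x ≢ y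

  _⊏?_ : ∀ x y → Dec (x ⊏ y)
  x ⊏? y = (x ⊑? y) ×-dec ¬? (x Fin.≟ y)

  ⊏-⊑-trans : ∀ {x y z} → x ⊏ y → y ⊑ z → x ⊏ z
  ⊏-⊑-trans (x⊑y , x≢y) y⊑z = ⊑-trans x⊑y y⊑z , λ { refl → x≢y (⊑-antisym x⊑y y⊑z) }

  ⊏-asym : ∀ {x y} → x ⊏ y → ¬ y ⊑ x
  ⊏-asym (x⊑y , x≢y) y⊑x = x≢y (⊑-antisym x⊑y y⊑x)

  ⊑∨ˡ : ∀ x y → x ⊑ (x ∨ y)
  ⊑∨ˡ x y = proj₁ (∨-supremum x y)

  ⊑∨ʳ : ∀ x y → y ⊑ (x ∨ y)
  ⊑∨ʳ x y = proj₁ (proj₂ (∨-supremum x y))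

  ∨-least : ∀ {x y z} → x ⊑ z → y ⊑ z → (x ∨ y) ⊑ z
  ∨-least {x} {y} {z} = proj₂ (proj₂ (∨-supremum x y)) z

  -- The axiom `ρ-cover` concerns covers, so the interval is cut at intermediate elements until only
  -- covers remain; each cut lowers the upper end or raises the lower end.
  ρ-strict : ∀ x y → x ⊏ y → ρ x < ρ y
  ρ-strict x y = go (po-wellFounded isPartialOrder y) (po-noetherian isPartialOrder x)
    where
    go : ∀ {x y} → Acc _⊏_ y → Acc (flip _⊏_) x → x ⊏ y → ρ x < ρ y
    go {x} {y} (acc below) (acc above) x⊏y with any? (λ z → (x ⊏? z) ×-dec (z ⊏? y))
    ... | yes (z , x⊏z , z⊏y) = <-trans (go (below z⊏y) (acc above) x⊏z) (go (acc below) (above x⊏z) z⊏y)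
    ... | no none = ≤-reflexive (sym (ρ-cover x y (x⊏y , between)))
      where
      between : ∀ z → x ⊑ z → z ⊑ y → z ≡ x ⊎ z ≡ y
      between z x⊑z z⊑y with z Fin.≟ x | z Fin.≟ y
      ... | yes z≡x | _       = inj₁ z≡x
      ... | no  _   | yes z≡y = inj₂ z≡y
      ... | no  z≢x | no  z≢y = ⊥-elim (none (z , (x⊑z , z≢x ∘ sym) , (z⊑y , z≢y)))

  ⊑-ρ-equal : ∀ {x y} → x ⊑ y → ρ y ≤ ρ x → x ≡ y
  ⊑-ρ-equal {x} {y} x⊑y le with x Fin.≟ y
  ... | yes x≡y = x≡y
  ... | no  x≢y = ⊥-elim (<⇒≱ (ρ-strict x y (x⊑y , x≢y)) le)

  Atom : Fin N → Set
  Atom = Covers _⊑_ bot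

  atom? : ∀ a → Dec (Atom a)
  atom? a = ((bot ⊑? a) ×-dec ¬? (bot Fin.≟ a)) ×-dec
    all? (λ z → (bot ⊑? z) →-dec ((z ⊑? a) →-dec ((z Fin.≟ bot) ⊎-dec (z Fin.≟ a))))

  x⊏x∨a : ∀ {x a} → ¬ a ⊑ x → x ⊏ (x ∨ a)
  x⊏x∨a {x} {a} a⋢x = ⊑∨ˡ x a , λ eq → a⋢x (subst (a ⊑_) (sym eq) (⊑∨ʳ x a))

  -- An atom has rank 1, so semimodularity bounds the rank of the join from above; strictness of `ρ`
  -- bounds it from below.
  ρ-∨-atom : ∀ {x a} → Atom a → ¬ a ⊑ x → ρ (x ∨ a) ≡ suc (ρ x)
  ρ-∨-atom {x} {a} atom a⋢x = ≤-antisym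
    (begin
      ρ (x ∨ a)              ≤⟨ m≤m+n _ (ρ (x ∧ a)) ⟩
      ρ (x ∨ a) + ρ (x ∧ a)  ≤⟨ semimodular x a ⟩
      ρ x + ρ a              ≡⟨ cong (ρ x +_) (trans (ρ-cover bot a atom) (cong suc ρ-bot)) ⟩
      ρ x + 1                ≡⟨ +-comm (ρ x) 1 ⟩
      suc (ρ x)              ∎)
    (ρ-strict x (x ∨ a) (x⊏x∨a a⋢x))
    where open ≤-Reasoning

  -- The join `x ∨ c` lies below `x ∨ b` and has the same rank, so the two coincide. This is the
  -- exchange property of the matroid of atoms.
  exchange : ∀ {x b c} → Atom b → ¬ b ⊑ x → Atom c → ¬ c ⊑ x → c ⊑ (x ∨ b) → b ⊑ (x ∨ c)
  exchange {x} {b} {c} atom-b b⋢x atom-c c⋢x c⊑ = subst (b ⊑_) (sym eq) (⊑∨ʳ x b)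
    where
    eq : (x ∨ c) ≡ (x ∨ b)
    eq = ⊑-ρ-equal (∨-least (⊑∨ˡ x b) c⊑)
      (≤-reflexive (trans (ρ-∨-atom atom-b b⋢x) (sym (ρ-∨-atom atom-c c⋢x))))

  -- The minimal label of the interval [x, z] is at least t.
  Beyond : ℕ → Fin N → Fin N → Set
  Beyond t x z = ∀ c → Atom c → c ⊑ z → ¬ c ⊑ x → t ≤ val c

  beyond? : ∀ t x z → Dec (Beyond t x z)
  beyond? t x z = all? (λ c → atom? c →-dec ((c ⊑? z) →-dec (¬? (c ⊑? x) →-dec (t ≤? val c))))

  -- The atom a is the label of the cover x < x ∨ a.
  Label : Fin N → Fin N → Set
  Label x a = Atom a × ¬ a ⊑ x × Beyond (val a) x (x ∨ a)

  label? : ∀ x a → Dec (Label x a)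
  label? x a = atom? a ×-dec (¬? (a ⊑? x) ×-dec beyond? (val a) x (x ∨ a))

  -- A label `a` determines its cover, which leads to `x ∨ a`, so a maximal chain from `x` to `top`
  -- can be encoded by its labels alone.
  Valid : Fin N → List (Fin N) → Set
  Valid x []      = x ≡ top
  Valid x (a ∷ w) = Label x a × Valid (x ∨ a) w

  valid? : ∀ x w → Dec (Valid x w)
  valid? x []      = x Fin.≟ top
  valid? x (a ∷ w) = label? x a ×-dec valid? (x ∨ a) w

  valid-length : ∀ {x} w → Valid x w → ρ x + length w ≡ rank
  valid-length []      refl = +-identityʳ _
  valid-length {x} (a ∷ w) ((atom , a⋢x , _) , v) =
    trans (+-suc (ρ x) (length w))
          (trans (cong (_+ length w) (sym (ρ-∨-atom atom a⋢x))) (valid-length w v))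

  valid-fresh : ∀ {x} w → Valid x w → All (λ c → ¬ c ⊑ x) w
  valid-fresh []      _ = []
  valid-fresh {x} (a ∷ w) ((_ , a⋢x , _) , v) =
    a⋢x ∷ All.map (λ c⋢ c⊑x → c⋢ (⊑-trans c⊑x (⊑∨ˡ x a))) (valid-fresh w v)

  valid-unique : ∀ {x} w → Valid x w → Unique w
  valid-unique []      _       = []
  valid-unique {x} (a ∷ w) (_ , v) =
    All.map (λ { c⋢ refl → c⋢ (⊑∨ʳ x a) }) (valid-fresh w v) ∷ valid-unique w v

  ∨-swap-⊑ : ∀ x a b → ((x ∨ a) ∨ b) ⊑ ((x ∨ b) ∨ a)
  ∨-swap-⊑ x a b = ∨-least (∨-least (⊑-trans (⊑∨ˡ x b) (⊑∨ˡ (x ∨ b) a)) (⊑∨ʳ (x ∨ b) a))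
                           (⊑-trans (⊑∨ʳ x b) (⊑∨ˡ (x ∨ b) a))

  -- An atom new in `x ∨ b` cannot lie below `x ∨ a`, or else exchange would put `b` below `x ∨ a`.
  -- It is therefore also new over `x ∨ a`, where `b` is least.
  label-swap : ∀ {x a b} → val a < val b → Label x a → Label (x ∨ a) b → Label x b × Label (x ∨ b) a
  label-swap {x} {a} {b} a<b (atom-a , a⋢x , least-a) (atom-b , b⋢x∨a , least-b) =
    (atom-b , b⋢x , least-b′) , (atom-a , a⋢x∨b , least-a′)
    where
    b⋢x : ¬ b ⊑ x
    b⋢x b⊑x = b⋢x∨a (⊑-trans b⊑x (⊑∨ˡ x a))
    a⋢x∨b : ¬ a ⊑ (x ∨ b)
    a⋢x∨b = b⋢x∨a ∘ exchange atom-b b⋢x atom-a a⋢x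
    least-b′ : Beyond (val b) x (x ∨ b)
    least-b′ c atom-c c⊑x∨b c⋢x with c ⊑? (x ∨ a)
    ... | yes c⊑x∨a = ⊥-elim (b⋢x∨a (⊑-trans (exchange atom-b b⋢x atom-c c⋢x c⊑x∨b) (∨-least (⊑∨ˡ x a) c⊑x∨a)))
    ... | no  c⋢x∨a = least-b c atom-c
      (⊑-trans c⊑x∨b (∨-least (⊑-trans (⊑∨ˡ x a) (⊑∨ˡ (x ∨ a) b)) (⊑∨ʳ (x ∨ a) b))) c⋢x∨a
    least-a′ : Beyond (val a) (x ∨ b) ((x ∨ b) ∨ a)
    -- Such an atom is new either in `x ∨ a`, where the least label is `a`, or over `x ∨ a`, where
    -- the least label is `b`, which exceeds `a`.
    least-a′ c atom-c c⊑ c⋢x∨b with c ⊑? (x ∨ a)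
    ... | yes c⊑x∨a = least-a c atom-c c⊑x∨a (λ c⊑x → c⋢x∨b (⊑-trans c⊑x (⊑∨ˡ x b)))
    ... | no  c⋢x∨a = ≤-trans (<⇒≤ a<b) (least-b c atom-c (⊑-trans c⊑ (∨-swap-⊑ x b a)) c⋢x∨a)

  -- Both orders of joining arrive at the same element, so the tail of the word stays valid.
  valid-swap : ∀ {x} p {a b s} → val a < val b → Valid x (p ++ a ∷ b ∷ s) → Valid x (p ++ b ∷ a ∷ s)
  valid-swap {x} [] {a} {b} {s} a<b (label-a , label-b , v) with label-swap a<b label-a label-b
  ... | label-b′ , label-a′ =
    label-b′ , label-a′ , subst (λ y → Valid y s) (⊑-antisym (∨-swap-⊑ x a b) (∨-swap-⊑ x b a)) v
  valid-swap (c ∷ p) a<b (label , v) = label , valid-swap p a<b v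

  -- Atomicity supplies a new atom: if all atoms below `z` were below `x`, then `z` would be below
  -- `x`.
  least-new-atom : ∀ {x z} → x ⊏ z → ∃ λ m → Atom m × m ⊑ z × ¬ m ⊑ x × Beyond (val m) x z
  least-new-atom {x} {z} x⊏z = m , atom-m , m⊑z , m⋢x ,
    λ c atom-c c⊑z c⋢x → s≤s (≮⇒≥ (least c (atom-c , c⊑z , c⋢x)))
    where
    New : Fin N → Set
    New c = Atom c × c ⊑ z × ¬ c ⊑ x
    new? : Decidable New
    new? c = atom? c ×-dec ((c ⊑? z) ×-dec ¬? (c ⊑? x))
    some : ∃ New
    some with any? new?
    ... | yes c = c
    ... | no none = ⊥-elim (⊏-asym x⊏z (atomic z x λ a atom-a a⊑z → stable a atom-a a⊑z (a ⊑? x)))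
      where
      stable : ∀ a → Atom a → a ⊑ z → Dec (a ⊑ x) → a ⊑ x
      stable a atom-a a⊑z (yes a⊑x) = a⊑x
      stable a atom-a a⊑z (no a⋢x)  = ⊥-elim (none (a , atom-a , a⊑z , a⋢x))
    found = minimal-element <-wellFounded Fin._<?_ new? (proj₁ some) (proj₂ some)
    m = proj₁ found
    atom-m = proj₁ (proj₁ (proj₂ found))
    m⊑z = proj₁ (proj₂ (proj₁ (proj₂ found)))
    m⋢x = proj₂ (proj₂ (proj₁ (proj₂ found)))
    least = proj₂ (proj₂ found)

  -- Expresses that an increasing chain from `x` to `z` with labels at least `t` can begin with `b`.
  -- The rest of that chain enters only through the least label of the interval from `x ∨ b` to `z`.
  FirstStep : ℕ → Fin N → Fin N → Fin N → Set
  FirstStep t x z b = t ≤ val b × Label x b × (x ∨ b) ⊑ z × Beyond (val b) (x ∨ b) z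

  firstStep? : ∀ t x z b → Dec (FirstStep t x z b)
  firstStep? t x z b = (t ≤? val b) ×-dec (label? x b ×-dec (((x ∨ b) ⊑? z) ×-dec beyond? (val b) (x ∨ b) z))

  -- The edge-lexicographic property: an interval has exactly one increasing chain, and it starts with the least label.
  ∑-firstStep : ∀ t x z → ∑ (allFin N) (λ b → 𝟙 (firstStep? t x z b)) ≡ 𝟙 ((x ⊏? z) ×-dec beyond? t x z)
  ∑-firstStep t x z = go ((x ⊏? z) ×-dec beyond? t x z)
    where
    sound : ∀ b → FirstStep t x z b → x ⊏ z × Beyond t x z
    sound b (t≤b , (_ , b⋢x , least-b) , x∨b⊑z , beyond) = ⊏-⊑-trans (x⊏x∨a b⋢x) x∨b⊑z , far
      where
      far : Beyond t x z
      far c atom-c c⊑z c⋢x with c ⊑? (x ∨ b)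
      ... | yes c⊑x∨b = ≤-trans t≤b (least-b c atom-c c⊑x∨b c⋢x)
      ... | no  c⋢x∨b = ≤-trans t≤b (beyond c atom-c c⊑z c⋢x∨b)

    go : (d : Dec (x ⊏ z × Beyond t x z)) → ∑ (allFin N) (λ b → 𝟙 (firstStep? t x z b)) ≡ 𝟙 d
    go (no ¬d) = ∑-zero (allFin N) (λ b → 𝟙-no (firstStep? t x z b) (¬d ∘ sound b))
    go (yes (x⊏z , beyond)) with least-new-atom x⊏z
    ... | m , atom-m , m⊑z , m⋢x , least-m = trans
      (∑-allFin-single m _ (λ b b≢m → 𝟙-no (firstStep? t x z b) (b≢m ∘ unique b)))
      (𝟙-yes (firstStep? t x z m) (beyond m atom-m m⊑z m⋢x , (atom-m , m⋢x , least-label) , x∨m⊑z , least-rest))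
      where
      x∨m⊑z : (x ∨ m) ⊑ z
      x∨m⊑z = ∨-least (proj₁ x⊏z) m⊑z
      least-label : Beyond (val m) x (x ∨ m)
      least-label c atom-c c⊑ = least-m c atom-c (⊑-trans c⊑ x∨m⊑z)
      least-rest : Beyond (val m) (x ∨ m) z
      least-rest c atom-c c⊑z c⋢ = least-m c atom-c c⊑z (λ c⊑x → c⋢ (⊑-trans c⊑x (⊑∨ˡ x m)))
      unique : ∀ b → FirstStep t x z b → b ≡ m
      unique b (_ , (atom-b , b⋢x , least-b) , x∨b⊑z , rest) =
        val-injective (≤-antisym b≤m (least-m b atom-b (⊑-trans (⊑∨ʳ x b) x∨b⊑z) b⋢x))
        where
        -- The atom `m` either becomes covered in the first step, whose least new atom is `b`, or is
        -- still new in the rest, whose labels are at least `b`.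
        b≤m : val b ≤ val m
        b≤m with m ⊑? (x ∨ b)
        ... | yes m⊑x∨b = least-b m atom-m m⊑x∨b m⋢x
        ... | no  m⋢x∨b = rest m atom-m m⊑z m⋢x∨b

  -- The number of chains x = y₀ < y₁ < ⋯ < yⱼ = top.
  chains : ℕ → Fin N → ℕ
  chains zero    x = 𝟙 (x Fin.≟ top)
  chains (suc j) x = ∑ (allFin N) (λ z → 𝟙 (x ⊏? z) * chains j z)

  -- The chains whose first interval is refined by an increasing chain with labels at least `t`.
  chains-beyond : ℕ → ℕ → Fin N → ℕ
  chains-beyond t j x = ∑ (allFin N) (λ z → 𝟙 ((x ⊏? z) ×-dec beyond? t x z) * chains j z)

  -- The summand `chains j y` supplies the missing case z = y, where the condition on new atoms is
  -- vacuous.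
  chains-weak : ∀ t j y →
    chains j y + chains-beyond t j y ≡ ∑ (allFin N) (λ z → 𝟙 ((y ⊑? z) ×-dec beyond? t y z) * chains j z)
  chains-weak t j y = begin
    chains j y + chains-beyond t j y
      ≡⟨ cong (_+ chains-beyond t j y) (sym at-y) ⟩
    ∑ (allFin N) (λ z → 𝟙 (z Fin.≟ y) * chains j z) + chains-beyond t j y
      ≡⟨ sym (∑-+ (allFin N) _ _) ⟩
    ∑ (allFin N) (λ z → 𝟙 (z Fin.≟ y) * chains j z + 𝟙 ((y ⊏? z) ×-dec beyond? t y z) * chains j z)
      ≡⟨ (∑-cong (allFin N) λ z → trans (sym (*-distribʳ-+ (chains j z) (𝟙 (z Fin.≟ y)) _))
                                        (cong (_* chains j z) (cases z (z Fin.≟ y)))) ⟩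
    ∑ (allFin N) (λ z → 𝟙 ((y ⊑? z) ×-dec beyond? t y z) * chains j z) ∎
    where
    open ≡-Reasoning
    at-y : ∑ (allFin N) (λ z → 𝟙 (z Fin.≟ y) * chains j z) ≡ chains j y
    at-y = trans (∑-allFin-single y _ (λ z z≢y → cong (_* chains j z) (𝟙-no (z Fin.≟ y) z≢y)))
                 (trans (cong (_* chains j y) (𝟙-yes (y Fin.≟ y) refl)) (*-identityˡ _))
    cases : ∀ z (d : Dec (z ≡ y)) →
      𝟙 d + 𝟙 ((y ⊏? z) ×-dec beyond? t y z) ≡ 𝟙 ((y ⊑? z) ×-dec beyond? t y z)
    cases z (yes refl) = trans
      (cong suc (𝟙-no ((y ⊏? y) ×-dec beyond? t y y) (λ ((_ , y≢y) , _) → y≢y refl)))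
      (sym (𝟙-yes ((y ⊑? y) ×-dec beyond? t y y) (⊑-refl , λ c _ c⊑y c⋢y → ⊥-elim (c⋢y c⊑y))))
    cases z (no z≢y) = 𝟙-cong ((y ⊏? z) ×-dec beyond? t y z) ((y ⊑? z) ×-dec beyond? t y z)
      (λ ((y⊑z , _) , bz) → y⊑z , bz) (λ (y⊑z , bz) → (y⊑z , z≢y ∘ sym) , bz)

  -- Marks that include all descents cut a word into `j + 1` increasing pieces. The ends of the
  -- pieces form a chain, from which the edge-lexicographic property recovers the pieces. The bound
  -- on `m` makes room for every maximal chain above `x`.
  ∑-valid-beyond : ∀ m x t j → rank ≤ ρ x + m →
    ∑ (words N m) (λ w → 𝟙 (valid? x w) * (𝟙 (t ≤? first 0 w) * markings w j)) ≡ chains-beyond t j x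

  ∑-valid-markings : ∀ m x j → rank ≤ ρ x + m →
    ∑ (words N m) (λ w → 𝟙 (valid? x w) * markings w j) ≡ chains (suc j) x
  ∑-valid-markings m x j le = begin
    ∑ (words N m) (λ w → 𝟙 (valid? x w) * markings w j)
      ≡⟨ (∑-cong (words N m) λ w → cong (𝟙 (valid? x w) *_)
           (trans (sym (*-identityˡ (markings w j))) (cong (_* markings w j) (sym (𝟙-yes (0 ≤? first 0 w) z≤n))))) ⟩
    ∑ (words N m) (λ w → 𝟙 (valid? x w) * (𝟙 (0 ≤? first 0 w) * markings w j))
      ≡⟨ ∑-valid-beyond m x 0 j le ⟩
    chains-beyond 0 j x
      ≡⟨ (∑-cong (allFin N) λ z → cong (_* chains j z)
           (𝟙-cong ((x ⊏? z) ×-dec beyond? 0 x z) (x ⊏? z) proj₁ (λ x⊏z → x⊏z , λ _ _ _ _ → z≤n))) ⟩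
    chains (suc j) x ∎
    where open ≡-Reasoning

  -- If the position behind `b` is marked, the remaining chain starts afresh at `y`; if not, the
  -- next label must be at least `b`. For j = 0 the first case is that of the empty tail.
  ∑-valid-after : ∀ m y b j → rank ≤ ρ y + m →
    ∑ (words N m) (λ w → 𝟙 (valid? y w) * markings (b ∷ w) j) ≡ chains j y + chains-beyond (val b) j y
  ∑-valid-after m y b zero le =
    trans (∑-cong (words N m) (λ w → *-distribˡ-+ (𝟙 (valid? y w)) (1 ∸ nonempty w) _))
    (trans (∑-+ (words N m) _ _)
    (cong₂ _+_
      (trans (∑-words-[] m (λ w → 𝟙 (valid? y w) * (1 ∸ nonempty w)) (λ a w → *-zeroʳ (𝟙 (valid? y (a ∷ w)))))
             (*-identityʳ _))
      (∑-valid-beyond m y (val b) 0 le)))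
  ∑-valid-after m y b (suc j) le =
    trans (∑-cong (words N m) (λ w → *-distribˡ-+ (𝟙 (valid? y w)) (markings w j) _))
    (trans (∑-+ (words N m) _ _)
    (cong₂ _+_ (∑-valid-markings m y j le) (∑-valid-beyond m y (val b) (suc j) le)))

  ∑-valid-beyond zero x t j le =
    trans (trans (+-identityʳ _)
                 (trans (cong (𝟙 (valid? x []) *_) (*-zeroʳ (𝟙 (t ≤? 0)))) (*-zeroʳ (𝟙 (valid? x [])))))
      -- The rank bound leaves no element strictly above `x`.
      (sym (∑-zero (allFin N) (λ z → cong (_* chains j z) (𝟙-no ((x ⊏? z) ×-dec beyond? t x z)
        (λ (x⊏z , _) → <⇒≱ (ρ-strict x top (⊏-⊑-trans x⊏z (top-max z)))
                            (subst (rank ≤_) (+-identityʳ (ρ x)) le))))))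
  ∑-valid-beyond (suc m) x t j le = begin
    ∑ (words N (suc m)) F
      ≡⟨ ∑-words-suc m F ⟩
    F [] + ∑ letters (λ b → ∑ W (λ w → F (b ∷ w)))
      ≡⟨ cong (_+ ∑ letters (λ b → ∑ W (λ w → F (b ∷ w))))
           (trans (cong (𝟙 (valid? x []) *_) (*-zeroʳ (𝟙 (t ≤? 0)))) (*-zeroʳ (𝟙 (valid? x [])))) ⟩
    ∑ letters (λ b → ∑ W (λ w → F (b ∷ w)))
      ≡⟨ (∑-cong letters λ b → trans (∑-cong W (factor b)) (∑-*ˡ W (τ b * 𝟙 (label? x b)) _)) ⟩
    ∑ letters (λ b → τ b * 𝟙 (label? x b) * ∑ W (λ w → 𝟙 (valid? (x ∨ b) w) * markings (b ∷ w) j))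
      ≡⟨ (∑-cong letters λ b → trans (*-assoc (τ b) (𝟙 (label? x b)) _)
           (trans (cong (τ b *_) (𝟙-guard (label? x b) (below b))) (sym (*-assoc (τ b) (𝟙 (label? x b)) _)))) ⟩
    ∑ letters (λ b → τ b * 𝟙 (label? x b) * ∑ letters (λ z → 𝟙 (rest? b z) * chains j z))
      ≡⟨ (∑-cong letters λ b → trans (sym (∑-*ˡ letters (τ b * 𝟙 (label? x b)) _))
           (∑-cong letters (collect b))) ⟩
    ∑ letters (λ b → ∑ letters (λ z → chains j z * 𝟙 (firstStep? t x z b)))
      ≡⟨ ∑-comm letters letters (λ b z → chains j z * 𝟙 (firstStep? t x z b)) ⟩
    ∑ letters (λ z → ∑ letters (λ b → chains j z * 𝟙 (firstStep? t x z b)))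
      ≡⟨ (∑-cong letters λ z → trans (∑-*ˡ letters (chains j z) (λ b → 𝟙 (firstStep? t x z b)))
           (trans (cong (chains j z *_) (∑-firstStep t x z)) (*-comm (chains j z) _))) ⟩
    chains-beyond t j x ∎
    where
    open ≡-Reasoning
    letters = allFin N
    W = words N m
    τ : Fin N → ℕ
    τ b = 𝟙 (t ≤? val b)
    F : List (Fin N) → ℕ
    F w = 𝟙 (valid? x w) * (𝟙 (t ≤? first 0 w) * markings w j)
    rest? : ∀ b z → Dec ((x ∨ b) ⊑ z × Beyond (val b) (x ∨ b) z)
    rest? b z = ((x ∨ b) ⊑? z) ×-dec beyond? (val b) (x ∨ b) z
    factor : ∀ b w → F (b ∷ w) ≡ τ b * 𝟙 (label? x b) * (𝟙 (valid? (x ∨ b) w) * markings (b ∷ w) j)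
    factor b w = trans (cong (_* (τ b * markings (b ∷ w) j)) (𝟙-× (label? x b) (valid? (x ∨ b) w)))
                       (shuffle (𝟙 (label? x b)) (𝟙 (valid? (x ∨ b) w)) (τ b) (markings (b ∷ w) j))
      where
      shuffle : ∀ l v t m → l * v * (t * m) ≡ t * l * (v * m)
      shuffle = solve-∀
    below : ∀ b → Label x b → ∑ W (λ w → 𝟙 (valid? (x ∨ b) w) * markings (b ∷ w) j) ≡
                              ∑ letters (λ z → 𝟙 (rest? b z) * chains j z)
    below b (atom-b , b⋢x , _) = trans
      (∑-valid-after m (x ∨ b) b j
        (subst (rank ≤_) (trans (+-suc (ρ x) m) (cong (_+ m) (sym (ρ-∨-atom atom-b b⋢x)))) le))
      (chains-weak (val b) j (x ∨ b))
    collect : ∀ b z → τ b * 𝟙 (label? x b) * (𝟙 (rest? b z) * chains j z) ≡ chains j z * 𝟙 (firstStep? t x z b)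
    collect b z = trans
      (shuffle (τ b) (𝟙 (label? x b)) (𝟙 (rest? b z)) (chains j z))
      (cong (chains j z *_) (sym (trans (𝟙-× (t ≤? val b) (label? x b ×-dec rest? b z))
                                        (cong (τ b *_) (𝟙-× (label? x b) (rest? b z))))))
      where
      shuffle : ∀ t l r k → t * l * (r * k) ≡ k * (t * (l * r))
      shuffle = solve-∀

-- Faces of the order complex

∑-allSubsets-suc : ∀ n (G : Subset (suc n) → ℕ) →
  ∑ (allSubsets (suc n)) G ≡ ∑ (allSubsets n) (λ S → G (outside ∷ S)) + ∑ (allSubsets n) (λ S → G (inside ∷ S))
∑-allSubsets-suc n G = trans (∑-++ (map (outside ∷_) (allSubsets n)) (map (inside ∷_) (allSubsets n)) G)
  (cong₂ _+_ (∑-map (outside ∷_) (allSubsets n) G) (∑-map (inside ∷_) (allSubsets n) G))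

-- Removing `y` is a bijection from the subsets that contain `y` to those that do not.
∑-allSubsets-remove : ∀ n (y : Fin n) (G : Subset n → ℕ) →
  ∑ (allSubsets n) (λ S → 𝟙 (y ∈? S) * G (S [ y ]≔ outside)) ≡ ∑ (allSubsets n) (λ S → 𝟙 (¬? (y ∈? S)) * G S)
∑-allSubsets-remove (suc n) zero G =
  trans (∑-allSubsets-suc n _)
  (trans (+-comm (∑ (allSubsets n) (λ _ → 0)) _)
  (sym (∑-allSubsets-suc n _)))
∑-allSubsets-remove (suc n) (suc y) G =
  trans (∑-allSubsets-suc n _)
  (trans (cong₂ _+_ (∑-allSubsets-remove n y (λ S → G (outside ∷ S)))
                    (∑-allSubsets-remove n y (λ S → G (inside ∷ S))))
  (sym (∑-allSubsets-suc n _)))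

∑-allSubsets-empty : ∀ n → ∑ (allSubsets n) (λ S → 𝟙 (∣ S ∣ ≟ 0)) ≡ 1
∑-allSubsets-empty zero    = refl
∑-allSubsets-empty (suc n) =
  trans (∑-allSubsets-suc n _)
        (cong₂ _+_ (∑-allSubsets-empty n) (∑-zero (allSubsets n) (λ S → 𝟙-no (suc ∣ S ∣ ≟ 0) (λ ()))))

∈-remove⁻ : ∀ {n} {y z : Fin n} (S : Subset n) → z ∈ₛ (S [ y ]≔ outside) → z ∈ₛ S × z ≢ y
∈-remove⁻ {y = zero}  (_ ∷ S) (there z∈) = there z∈ , λ ()
∈-remove⁻ {y = suc y} (_ ∷ S) here       = here , λ ()
∈-remove⁻ {y = suc y} (_ ∷ S) (there z∈) with ∈-remove⁻ S z∈
... | z∈S , z≢y = there z∈S , λ { refl → z≢y refl }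

∣remove∣ : ∀ {n} {y : Fin n} (S : Subset n) → y ∈ₛ S → ∣ S ∣ ≡ suc ∣ S [ y ]≔ outside ∣
∣remove∣ (inside  ∷ S) here       = refl
∣remove∣ (inside  ∷ S) (there y∈) = cong suc (∣remove∣ S y∈)
∣remove∣ (outside ∷ S) (there y∈) = ∣remove∣ S y∈

∣S∣>0⇒nonempty : ∀ {n} (S : Subset n) {j} → ∣ S ∣ ≡ suc j → ∃ (_∈ₛ S)
∣S∣>0⇒nonempty (inside  ∷ S) _  = zero , here
∣S∣>0⇒nonempty (outside ∷ S) eq with ∣S∣>0⇒nonempty S eq
... | y , y∈S = suc y , there y∈S

module Faces (L : GeometricLattice) where

  open Labelling L

  -- Faces are the case x = `bot`; a general `x` allows induction by removing the minimum, which
  -- takes the place of `x`.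
  ChainAbove : Fin N → ℕ → Subset N → Set
  ChainAbove x j S = (∀ y → y ∈ₛ S → x ⊏ y × y ≢ top)
                   × (∀ y z → y ∈ₛ S → z ∈ₛ S → y ⊑ z ⊎ z ⊑ y)
                   × ∣ S ∣ ≡ j

  chainAbove? : ∀ x j S → Dec (ChainAbove x j S)
  chainAbove? x j S =
    all? (λ y → (y ∈? S) →-dec ((x ⊏? y) ×-dec ¬? (y Fin.≟ top)))
    ×-dec (all? (λ y → all? (λ z → (y ∈? S) →-dec ((z ∈? S) →-dec ((y ⊑? z) ⊎-dec (z ⊑? y)))))
    ×-dec (∣ S ∣ ≟ j))

  MinimumAt : Fin N → ℕ → Subset N → Fin N → Set
  MinimumAt x j S y = y ∈ₛ S × (x ⊏ y × y ≢ top) × ChainAbove y j (S [ y ]≔ outside)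

  minimumAt? : ∀ x j S y → Dec (MinimumAt x j S y)
  minimumAt? x j S y = (y ∈? S) ×-dec (((x ⊏? y) ×-dec ¬? (y Fin.≟ top)) ×-dec chainAbove? y j (S [ y ]≔ outside))

  chain-minimum : ∀ {x j S} → ChainAbove x (suc j) S → ∃ (MinimumAt x j S)
  chain-minimum {x} {j} {S} (inner , comparable , size) = m , m∈S , inner m m∈S ,
    (λ z z∈ → let (z∈S , z≢m) = ∈-remove⁻ S z∈ in (m⊑ z z∈S , z≢m ∘ sym) , proj₂ (inner z z∈S)) ,
    (λ y z y∈ z∈ → comparable y z (proj₁ (∈-remove⁻ S y∈)) (proj₁ (∈-remove⁻ S z∈))) ,
    suc-injective (trans (sym (∣remove∣ S m∈S)) size)
    where
    some = ∣S∣>0⇒nonempty S size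
    found = minimal-element (po-wellFounded isPartialOrder) _⊏?_ (_∈? S) (proj₁ some) (proj₂ some)
    m = proj₁ found
    m∈S = proj₁ (proj₂ found)
    m⊑ : ∀ z → z ∈ₛ S → m ⊑ z
    m⊑ z z∈S with comparable m z m∈S z∈S | z Fin.≟ m
    ... | inj₁ m⊑z | _        = m⊑z
    ... | inj₂ _   | yes refl = ⊑-refl
    ... | inj₂ z⊑m | no z≢m   = ⊥-elim (proj₂ (proj₂ found) z z∈S (z⊑m , z≢m))

  add-minimum : ∀ {x j S y} → MinimumAt x j S y → ChainAbove x (suc j) S
  add-minimum {x} {j} {S} {y} (y∈S , (x⊏y , y≢top) , inner , comparable , size) =
    inner′ , comparable′ , trans (∣remove∣ S y∈S) (cong suc size)
    where
    rest : ∀ {z} → z ∈ₛ S → z ≢ y → z ∈ₛ (S [ y ]≔ outside)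
    rest {z} z∈S z≢y = []≔-minimal S z y z≢y z∈S
    inner′ : ∀ z → z ∈ₛ S → x ⊏ z × z ≢ top
    inner′ z z∈S with z Fin.≟ y
    ... | yes refl = x⊏y , y≢top
    ... | no  z≢y  = let (y⊏z , z≢top) = inner z (rest z∈S z≢y) in ⊏-⊑-trans x⊏y (proj₁ y⊏z) , z≢top
    comparable′ : ∀ u v → u ∈ₛ S → v ∈ₛ S → u ⊑ v ⊎ v ⊑ u
    comparable′ u v u∈S v∈S with u Fin.≟ y | v Fin.≟ y
    ... | yes refl | yes refl = inj₁ ⊑-refl
    ... | yes refl | no  v≢y  = inj₁ (proj₁ (proj₁ (inner v (rest v∈S v≢y))))
    ... | no  u≢y  | yes refl = inj₂ (proj₁ (proj₁ (inner u (rest u∈S u≢y))))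
    ... | no  u≢y  | no  v≢y  = comparable u v (rest u∈S u≢y) (rest v∈S v≢y)

  minimum-unique : ∀ {x j S y z} → MinimumAt x j S y → MinimumAt x j S z → y ≡ z
  minimum-unique {S = S} {y} {z} (y∈S , _ , above-y , _) (z∈S , _ , above-z , _) with y Fin.≟ z
  ... | yes y≡z = y≡z
  ... | no  y≢z = ⊥-elim (⊏-asym (proj₁ (above-y z ([]≔-minimal S z y (y≢z ∘ sym) z∈S)))
                                 (proj₁ (proj₁ (above-z y ([]≔-minimal S y z y≢z y∈S)))))

  ∑-minimumAt : ∀ x j S → ∑ (allFin N) (λ y → 𝟙 (minimumAt? x j S y)) ≡ 𝟙 (chainAbove? x (suc j) S)
  ∑-minimumAt x j S = go (chainAbove? x (suc j) S)
    where
    go : (d : Dec (ChainAbove x (suc j) S)) → ∑ (allFin N) (λ y → 𝟙 (minimumAt? x j S y)) ≡ 𝟙 d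
    go (no ¬c) = ∑-zero (allFin N) (λ y → 𝟙-no (minimumAt? x j S y) (¬c ∘ add-minimum))
    go (yes c) with chain-minimum c
    ... | m , min-m = trans
      (∑-allFin-single m _ (λ y y≢m → 𝟙-no (minimumAt? x j S y) (λ min-y → y≢m (minimum-unique min-y min-m))))
      (𝟙-yes (minimumAt? x j S m) min-m)

  #chainAbove : Fin N → ℕ → ℕ
  #chainAbove x j = ∑ (allSubsets N) (λ S → 𝟙 (chainAbove? x j S))

  #chainAbove-suc : ∀ x j →
    #chainAbove x (suc j) ≡ ∑ (allFin N) (λ y → 𝟙 ((x ⊏? y) ×-dec ¬? (y Fin.≟ top)) * #chainAbove y j)
  #chainAbove-suc x j = begin
    #chainAbove x (suc j)
      ≡⟨ ∑-cong (allSubsets N) (λ S → sym (∑-minimumAt x j S)) ⟩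
    ∑ (allSubsets N) (λ S → ∑ (allFin N) (λ y → 𝟙 (minimumAt? x j S y)))
      ≡⟨ ∑-comm (allSubsets N) (allFin N) (λ S y → 𝟙 (minimumAt? x j S y)) ⟩
    ∑ (allFin N) (λ y → ∑ (allSubsets N) (λ S → 𝟙 (minimumAt? x j S y)))
      ≡⟨ ∑-cong (allFin N) at ⟩
    ∑ (allFin N) (λ y → 𝟙 (inner? y) * #chainAbove y j) ∎
    where
    open ≡-Reasoning
    inner? : ∀ y → Dec (x ⊏ y × y ≢ top)
    inner? y = (x ⊏? y) ×-dec ¬? (y Fin.≟ top)
    at : ∀ y → ∑ (allSubsets N) (λ S → 𝟙 (minimumAt? x j S y)) ≡ 𝟙 (inner? y) * #chainAbove y j
    at y = begin
      ∑ (allSubsets N) (λ S → 𝟙 (minimumAt? x j S y))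
        ≡⟨ ∑-cong (allSubsets N) (λ S → 𝟙-× (y ∈? S) (inner? y ×-dec chainAbove? y j (S [ y ]≔ outside))) ⟩
      ∑ (allSubsets N) (λ S → 𝟙 (y ∈? S) * G (S [ y ]≔ outside))
        ≡⟨ ∑-allSubsets-remove N y G ⟩
      ∑ (allSubsets N) (λ S → 𝟙 (¬? (y ∈? S)) * G S)
        -- Members of a chain above `y` differ from `y`, so the absence of `y` is automatic.
        ≡⟨ ∑-cong (allSubsets N) (λ S → trans (sym (𝟙-× (¬? (y ∈? S)) (inner? y ×-dec chainAbove? y j S)))
             (𝟙-cong (¬? (y ∈? S) ×-dec (inner? y ×-dec chainAbove? y j S)) (inner? y ×-dec chainAbove? y j S) proj₂
               (λ (i , c) → (λ y∈S → proj₂ (proj₁ (proj₁ c y y∈S)) refl) , i , c))) ⟩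
      ∑ (allSubsets N) G
        ≡⟨ ∑-cong (allSubsets N) (λ S → 𝟙-× (inner? y) (chainAbove? y j S)) ⟩
      ∑ (allSubsets N) (λ S → 𝟙 (inner? y) * 𝟙 (chainAbove? y j S))
        ≡⟨ ∑-*ˡ (allSubsets N) (𝟙 (inner? y)) (λ S → 𝟙 (chainAbove? y j S)) ⟩
      𝟙 (inner? y) * #chainAbove y j ∎
      where
      G : Subset N → ℕ
      G S = 𝟙 (inner? y ×-dec chainAbove? y j S)

  chains-top : ∀ j → chains (suc j) top ≡ 0
  chains-top j = ∑-zero (allFin N) (λ z → cong (_* chains j z) (𝟙-no (top ⊏? z) (λ top⊏z → ⊏-asym top⊏z (top-max z))))

  -- Adding the ends `x` and `top` to `j` interior elements gives a chain of `j + 1` steps.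
  #chainAbove-chains : ∀ j x → x ≢ top → #chainAbove x j ≡ chains (suc j) x
  #chainAbove-chains zero x x≢top = begin
    #chainAbove x 0
      ≡⟨ ∑-cong (allSubsets N) (λ S → 𝟙-cong (chainAbove? x 0 S) (∣ S ∣ ≟ 0) (λ (_ , _ , size) → size) (empty S)) ⟩
    ∑ (allSubsets N) (λ S → 𝟙 (∣ S ∣ ≟ 0))
      ≡⟨ ∑-allSubsets-empty N ⟩
    1
      ≡⟨ sym (cong₂ _*_ (𝟙-yes (x ⊏? top) (top-max x , x≢top)) (𝟙-yes (top Fin.≟ top) refl)) ⟩
    𝟙 (x ⊏? top) * chains 0 top
      ≡⟨ sym (∑-allFin-single top _ (λ z z≢top →
           trans (cong (𝟙 (x ⊏? z) *_) (𝟙-no (z Fin.≟ top) z≢top)) (*-zeroʳ (𝟙 (x ⊏? z))))) ⟩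
    chains 1 x ∎
    where
    open ≡-Reasoning
    no-member : ∀ {y} S → ∣ S ∣ ≡ 0 → ¬ y ∈ₛ S
    no-member S size y∈S = 0≢1+n (trans (sym size) (∣remove∣ S y∈S))
    empty : ∀ S → ∣ S ∣ ≡ 0 → ChainAbove x 0 S
    empty S size = (λ y y∈S → ⊥-elim (no-member S size y∈S)) , (λ y z y∈S _ → ⊥-elim (no-member S size y∈S)) , size
  #chainAbove-chains (suc j) x x≢top = trans (#chainAbove-suc x j) (∑-cong (allFin N) at)
    where
    at : ∀ y → 𝟙 ((x ⊏? y) ×-dec ¬? (y Fin.≟ top)) * #chainAbove y j ≡ 𝟙 (x ⊏? y) * chains (suc j) y
    at y = trans (cong (_* #chainAbove y j) (𝟙-× (x ⊏? y) (¬? (y Fin.≟ top))))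
      (trans (*-assoc (𝟙 (x ⊏? y)) (𝟙 (¬? (y Fin.≟ top))) (#chainAbove y j))
             (cong (𝟙 (x ⊏? y) *_) (proper (y Fin.≟ top))))
      where
      proper : (d : Dec (y ≡ top)) → 𝟙 (¬? d) * #chainAbove y j ≡ chains (suc j) y
      -- An intermediate `top` is excluded on the left by definition and on the right because no
      -- chain of positive length starts there.
      proper (yes refl) = sym (chains-top j)
      proper (no y≢top) = trans (*-identityˡ _) (#chainAbove-chains j y y≢top)

  fvec-chains : bot ≢ top → ∀ j → fvec L j ≡ chains (suc j) bot
  fvec-chains bot≢top j = begin
    fvec L j
      ≡⟨ length-filter-∑ (faceOfSize? j) (allSubsets N) ⟩
    ∑ (allSubsets N) (λ S → 𝟙 (faceOfSize? j S))
      ≡⟨ ∑-cong (allSubsets N) (λ S → 𝟙-cong (faceOfSize? j S) (chainAbove? bot j S)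
           (λ ((proper , comparable) , size) →
             (λ y y∈S → let (y≢bot , y≢top) = proper y y∈S in (bot-min y , y≢bot ∘ sym) , y≢top) , comparable , size)
           (λ (inner , comparable , size) →
             ((λ y y∈S → let ((_ , bot≢y) , y≢top) = inner y y∈S in bot≢y ∘ sym , y≢top) , comparable) , size)) ⟩
    #chainAbove bot j
      ≡⟨ #chainAbove-chains j bot bot≢top ⟩
    chains (suc j) bot ∎
    where open ≡-Reasoning

-- The h-vector as a descent count

hvecAux≡hPartial : ∀ L k m → hvecAux L k m ≡ hPartial (r L) (fvec L) k m
hvecAux≡hPartial L k zero    = refl
hvecAux≡hPartial L k (suc m) = cong (ℤ._+ hTerm (r L) (fvec L) k (suc m)) (hvecAux≡hPartial L k m)

module _ (L : GeometricLattice) (r : ℕ) (rank≡ : GeometricLattice.rank L ≡ suc r) where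

  open Labelling L
  open Faces L

  bot-length : ∀ {w} → Valid bot w → length w ≡ suc r
  bot-length {w} v = trans (sym (cong (_+ length w) ρ-bot)) (trans (valid-length w v) rank≡)

  open SwapClosed r (Valid bot) (valid? bot) bot-length (λ {w} → valid-unique w) valid-swap

  -- Faces are chains from `bot` to `top`, hence label words with their descents marked, and each
  -- word contributes a single power of x. The index is `suc k` because the end of a word counts as
  -- a descent.
  hvec-#des : ∀ k → hvec L k ≡ pos #des (suc k)
  hvec-#des k = begin
    hvec L k
      ≡⟨ hvecAux≡hPartial L k k ⟩
    hTransform (rank ∸ 1) (fvec L) k
      ≡⟨ cong (λ n → hTransform (n ∸ 1) (fvec L) k) rank≡ ⟩
    hTransform r (fvec L) k
      ≡⟨ hPartial-cong r k k (λ j → trans (fvec-chains bot≢top j) (sym (∑-valid-markings (suc r) bot j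
           (≤-reflexive (trans rank≡ (cong (_+ suc r) (sym ρ-bot))))))) ⟩
    hTransform r (λ j → ∑ (words N (suc r)) (λ w → 𝟙 (valid? bot w) * markings w j)) k
      ≡⟨ hTransform-∑ r k (words N (suc r)) (λ w j → 𝟙 (valid? bot w) * markings w j)
           (λ w → 𝟙 (valid? bot w) * 𝟙 (des w ≟ suc k)) (λ w → at w (valid? bot w)) ⟩
    pos #des (suc k) ∎
    where
    open ≡-Reasoning
    bot≢top : bot ≢ top
    bot≢top eq = 0≢1+n (trans (sym ρ-bot) (trans (cong ρ eq) rank≡))
    at : ∀ w (d : Dec (Valid bot w)) →
      hTransform r (λ j → 𝟙 d * markings w j) k ≡ pos (𝟙 d * 𝟙 (des w ≟ suc k))
    at w (yes v) = trans (hPartial-cong r k k (λ j → *-identityˡ (markings w j)))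
      (trans (hTransform-markings r k 0 w (bot-length v)) (cong pos_ (sym (*-identityˡ _))))
    at w (no _)  = hPartial-0 r _ k k (λ _ → refl)

  hvec-ascend : ∀ i → 2 * suc i ≤ r → hvec L i ℤ.≤ hvec L (suc i)
  hvec-ascend i le = subst₂ ℤ._≤_ (sym (hvec-#des i)) (sym (hvec-#des (suc i)))
    (ℤ.+≤+ (#des-ascend (suc i) (≤-trans le (n≤1+n r))))

  hvec-reflect : ∀ i → 2 * i ≤ r → hvec L i ℤ.≤ hvec L (r ∸ i)
  hvec-reflect i le = subst₂ ℤ._≤_ (sym (hvec-#des i)) (sym (hvec-#des (r ∸ i)))
    -- Reflection takes i + 1 descents to r + 2 - (i + 1) = (r - i) + 1, which is the index of h at
    -- r - i.
    (ℤ.+≤+ (subst (λ k → #des (suc i) ≤ #des k) (+-∸-assoc 1 (≤-trans (m≤m+n i (i + 0)) le))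
      (#des-reflect (suc i) (≤-trans (≤-reflexive (*-suc 2 i)) (+-monoʳ-≤ 2 le)))))

theorem1p1 : (L : GeometricLattice) → (r : ℕ) → GeometricLattice.rank L ≡ suc r →
    (i : ℕ) → 2 * i ≤ r →
    ((1 ≤ i → hvec L (i ∸ 1) ℤ.≤ hvec L i) × (hvec L i ℤ.≤ hvec L (r ∸ i)))
theorem1p1 L r rank≡ i 2i≤r = ascend i 2i≤r , hvec-reflect L r rank≡ i 2i≤r
  where
  ascend : ∀ i → 2 * i ≤ r → 1 ≤ i → hvec L (i ∸ 1) ℤ.≤ hvec L i
  ascend (suc i) le _ = hvec-ascend L r rank≡ i le
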